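{- Let $n\ge1$ be an integer, let $\mathcal{P}_n\subset\mathbb{R}^n$ be the convex hull of all parking functions of length $n$, and for an integer $S$ let $\mathcal{P}_{n,S}$ be the set of points $x\in\mathcal{P}_n$ satisfying $x_1+\dots+x_n=S$. For each integer $S$ with $n+1\le S\le \frac{n(n+1)}{2}$ there is a unique pair of positive integers $(r,k)$ such that $k\le n-1$, $2\le r\le k+1$, $$\underbrace{1+\dots+1}_{k\text{ ones}}+r+(k+2)+(k+3)+\dots+n=S,$$ and, for this pair, the set of vertices of $\mathcal{P}_{n,S}$ is the set of permutations (rearrangements of coordinates) of $$(\underbrace{1,\dots,1}_{k\text{ ones}},r,k+2,k+3,\dots,n).$$ For $S=n$, the set of vertices of $\mathcal{P}_{n,n}$ consists of the single point $(1,\dots,1)$.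
   Context: A sequence $\alpha=(a_1,\dots,a_n)$ with $a_i\in\{1,\dots,n\}$ is a parking function of length $n$ if its weakly increasing rearrangement $b_1\le b_2\le\dots\le b_n$ satisfies $b_i\le i$ for all $i\in\{1,\dots,n\}$. When $k=n-1$ the sum $(k+2)+\dots+n$ is empty (equal to $0$), and the vector is $(1,\dots,1,r)$ with $n-1$ ones. A vertex of a polytope is a $0$-dimensional face. -}

module Defs where

open import Data.Bool.Base using (if_then_else_)
open import Data.Fin.Base using (Fin; toℕ)
open import Data.Fin.Permutation using (Permutation′; _⟨$⟩ʳ_)
open import Data.Integer.Base as ℤ using (ℤ; +_)
open import Data.Nat.Base as ℕ using (ℕ; suc; _∸_; _<ᵇ_; _≡ᵇ_)
import Data.Nat.Properties as ℕ
open import Data.Product.Base using (Σ; ∃; _×_; _,_)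
open import Data.Rational.Base as ℚ using (ℚ; 0ℚ; 1ℚ; ∣_∣)
import Data.Rational.Properties as ℚ
open import Data.Rational.Solver using (module +-*-Solver)
open import Data.Vec.Functional as Vector using (Vector)
open import Function.Base using (_∘_)
open import Function.Bundles using (_⇔_)
open import Relation.Binary.PropositionalEquality
  using (_≡_; refl; sym; trans; cong; cong₂; subst)

-- The real numbers (Cantor's construction): Cauchy sequences of
-- rationals, with equality modulo null sequences given by the setoid
-- relation _≈_.
Cauchy : (ℕ → ℚ) → Set
Cauchy s = ∀ ε → 0ℚ ℚ.< ε →
  ∃ λ N → ∀ m n → N ℕ.≤ m → N ℕ.≤ n → ∣ s m ℚ.- s n ∣ ℚ.< ε

record ℝ : Set where
  constructor mkℝ
  field
    seq    : ℕ → ℚ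
    cauchy : Cauchy seq

open ℝ public

infix 4 _≈_ _≤_

_≈_ : ℝ → ℝ → Set
x ≈ y = ∀ ε → 0ℚ ℚ.< ε →
  ∃ λ N → ∀ n → N ℕ.≤ n → ∣ seq x n ℚ.- seq y n ∣ ℚ.< ε

-- The slack ε is needed: x ≤ y also holds when seq x approaches seq y
-- from above.
_≤_ : ℝ → ℝ → Set
x ≤ y = ∀ ε → 0ℚ ℚ.< ε →
  ∃ λ N → ∀ n → N ℕ.≤ n → seq x n ℚ.≤ seq y n ℚ.+ ε

const-cauchy : ∀ q → Cauchy (λ _ → q)
const-cauchy q ε 0<ε = 0 , λ _ _ _ _ →
  subst (λ d → ∣ d ∣ ℚ.< ε) (sym (ℚ.+-inverseʳ q)) 0<ε

quotient : ∀ ε B → 0ℚ ℚ.< ε → 0ℚ ℚ.< B →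
           ∃ λ δ → 0ℚ ℚ.< δ × B ℚ.* δ ≡ ε
quotient ε B 0<ε 0<B = δ , 0<δ , Bδ≡ε
  where
  instance
    B-pos : ℚ.Positive B
    B-pos = ℚ.positive 0<B
    B-nonZero : ℚ.NonZero B
    B-nonZero = ℚ.pos⇒nonZero B
    1/B-pos : ℚ.Positive (ℚ.1/ B)
    1/B-pos = ℚ.1/pos⇒pos B
  δ : ℚ
  δ = ε ℚ.* ℚ.1/ B
  0<δ : 0ℚ ℚ.< δ
  0<δ = subst (ℚ._< δ) (ℚ.*-zeroˡ (ℚ.1/ B)) (ℚ.*-monoˡ-<-pos (ℚ.1/ B) 0<ε)
  Bδ≡ε : B ℚ.* δ ≡ ε
  Bδ≡ε = trans (ℚ.*-comm B δ) (trans (ℚ.*-assoc ε (ℚ.1/ B) B)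
    (trans (cong (ε ℚ.*_) (ℚ.*-inverseˡ B)) (ℚ.*-identityʳ ε)))

0<+ : ∀ {p q} → 0ℚ ℚ.< p → 0ℚ ℚ.< q → 0ℚ ℚ.< p ℚ.+ q
0<+ = ℚ.+-mono-<

0<1 : 0ℚ ℚ.< 1ℚ
0<1 = ℚ.positive⁻¹ 1ℚ

+-cauchy : ∀ s t → Cauchy s → Cauchy t → Cauchy (λ n → s n ℚ.+ t n)
+-cauchy s t cs ct ε 0<ε
  with δ , 0<δ , 2δ≡ε ← quotient ε (1ℚ ℚ.+ 1ℚ) 0<ε (0<+ 0<1 0<1)
  with M , hM ← cs δ 0<δ
  with N , hN ← ct δ 0<δ
  = M ℕ.⊔ N , bound
  where
  open ℚ.≤-Reasoning
  open +-*-Solver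
  bound : ∀ m n → M ℕ.⊔ N ℕ.≤ m → M ℕ.⊔ N ℕ.≤ n →
          ∣ (s m ℚ.+ t m) ℚ.- (s n ℚ.+ t n) ∣ ℚ.< ε
  bound m n m≥ n≥ = begin-strict
    ∣ (s m ℚ.+ t m) ℚ.- (s n ℚ.+ t n) ∣
      ≡⟨ cong ∣_∣ (solve 4 (λ a b c d → (a :+ b) :- (c :+ d)
           := (a :- c) :+ (b :- d)) refl (s m) (t m) (s n) (t n)) ⟩
    ∣ (s m ℚ.- s n) ℚ.+ (t m ℚ.- t n) ∣
      ≤⟨ ℚ.∣p+q∣≤∣p∣+∣q∣ (s m ℚ.- s n) (t m ℚ.- t n) ⟩
    ∣ s m ℚ.- s n ∣ ℚ.+ ∣ t m ℚ.- t n ∣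
      <⟨ ℚ.+-mono-<
           (hM m n (ℕ.m⊔n≤o⇒m≤o M N m≥) (ℕ.m⊔n≤o⇒m≤o M N n≥))
           (hN m n (ℕ.m⊔n≤o⇒n≤o M N m≥) (ℕ.m⊔n≤o⇒n≤o M N n≥)) ⟩
    δ ℚ.+ δ
      ≡⟨ solve 1 (λ d → d :+ d := (con 1ℚ :+ con 1ℚ) :* d) refl δ ⟩
    (1ℚ ℚ.+ 1ℚ) ℚ.* δ
      ≡⟨ 2δ≡ε ⟩
    ε ∎

bounded : ∀ s → Cauchy s →
  Σ ℚ λ B → 0ℚ ℚ.< B × ∃ λ N → ∀ n → N ℕ.≤ n → ∣ s n ∣ ℚ.≤ B
bounded s cs with N , h ← cs 1ℚ 0<1 =
  1ℚ ℚ.+ ∣ s N ∣ , ℚ.+-mono-<-≤ 0<1 (ℚ.0≤∣p∣ (s N)) , N , bound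
  where
  open ℚ.≤-Reasoning
  open +-*-Solver
  bound : ∀ n → N ℕ.≤ n → ∣ s n ∣ ℚ.≤ 1ℚ ℚ.+ ∣ s N ∣
  bound n n≥ = begin
    ∣ s n ∣
      ≡⟨ cong ∣_∣ (solve 2 (λ a b → a := (a :- b) :+ b) refl (s n) (s N)) ⟩
    ∣ (s n ℚ.- s N) ℚ.+ s N ∣
      ≤⟨ ℚ.∣p+q∣≤∣p∣+∣q∣ (s n ℚ.- s N) (s N) ⟩
    ∣ s n ℚ.- s N ∣ ℚ.+ ∣ s N ∣
      ≤⟨ ℚ.+-monoˡ-≤ ∣ s N ∣ (ℚ.<⇒≤ (h n N n≥ ℕ.≤-refl)) ⟩
    1ℚ ℚ.+ ∣ s N ∣ ∎

*-close : ∀ {a b c d B C δ} → 0ℚ ℚ.< B → 0ℚ ℚ.< C →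
          ∣ a ∣ ℚ.≤ B → ∣ d ∣ ℚ.≤ C → ∣ a ℚ.- c ∣ ℚ.< δ → ∣ b ℚ.- d ∣ ℚ.< δ →
          ∣ a ℚ.* b ℚ.- c ℚ.* d ∣ ℚ.< (B ℚ.+ C) ℚ.* δ
*-close {a} {b} {c} {d} {B} {C} {δ} 0<B 0<C a≤B d≤C ac<δ bd<δ = begin-strict
  ∣ a ℚ.* b ℚ.- c ℚ.* d ∣
    ≡⟨ cong ∣_∣ (solve 4 (λ a b c d → a :* b :- c :* d
         := a :* (b :- d) :+ (a :- c) :* d) refl a b c d) ⟩
  ∣ a ℚ.* (b ℚ.- d) ℚ.+ (a ℚ.- c) ℚ.* d ∣
    ≤⟨ ℚ.∣p+q∣≤∣p∣+∣q∣ (a ℚ.* (b ℚ.- d)) ((a ℚ.- c) ℚ.* d) ⟩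
  ∣ a ℚ.* (b ℚ.- d) ∣ ℚ.+ ∣ (a ℚ.- c) ℚ.* d ∣
    ≡⟨ cong₂ ℚ._+_ (ℚ.∣p*q∣≡∣p∣*∣q∣ a (b ℚ.- d))
                   (ℚ.∣p*q∣≡∣p∣*∣q∣ (a ℚ.- c) d) ⟩
  ∣ a ∣ ℚ.* ∣ b ℚ.- d ∣ ℚ.+ ∣ a ℚ.- c ∣ ℚ.* ∣ d ∣
    ≤⟨ ℚ.+-mono-≤
         (ℚ.*-monoʳ-≤-nonNeg ∣ b ℚ.- d ∣ {{ℚ.∣-∣-nonNeg (b ℚ.- d)}} a≤B)
         (ℚ.*-monoˡ-≤-nonNeg ∣ a ℚ.- c ∣ {{ℚ.∣-∣-nonNeg (a ℚ.- c)}} d≤C) ⟩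
  B ℚ.* ∣ b ℚ.- d ∣ ℚ.+ ∣ a ℚ.- c ∣ ℚ.* C
    <⟨ ℚ.+-mono-< (ℚ.*-monoʳ-<-pos B {{ℚ.positive 0<B}} bd<δ)
                  (ℚ.*-monoˡ-<-pos C {{ℚ.positive 0<C}} ac<δ) ⟩
  B ℚ.* δ ℚ.+ δ ℚ.* C
    ≡⟨ solve 3 (λ b c d → b :* d :+ d :* c := (b :+ c) :* d) refl B C δ ⟩
  (B ℚ.+ C) ℚ.* δ ∎
  where
  open ℚ.≤-Reasoning
  open +-*-Solver

*-cauchy : ∀ s t → Cauchy s → Cauchy t → Cauchy (λ n → s n ℚ.* t n)
*-cauchy s t cs ct ε 0<ε =
  let B , 0<B , K , hB = bounded s cs
      C , 0<C , L , hC = bounded t ct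
      δ , 0<δ , Dδ≡ε = quotient ε (B ℚ.+ C) 0<ε (0<+ 0<B 0<C)
      M , hM = cs δ 0<δ
      N , hN = ct δ 0<δ
      KL = K ℕ.⊔ L
      MN = M ℕ.⊔ N
  in KL ℕ.⊔ MN , λ m n m≥ n≥ →
    let m≥KL = ℕ.m⊔n≤o⇒m≤o KL MN m≥
        n≥KL = ℕ.m⊔n≤o⇒m≤o KL MN n≥
        m≥MN = ℕ.m⊔n≤o⇒n≤o KL MN m≥
        n≥MN = ℕ.m⊔n≤o⇒n≤o KL MN n≥
    in subst (∣ s m ℚ.* t m ℚ.- s n ℚ.* t n ∣ ℚ.<_) Dδ≡ε
      (*-close {s m} {t m} {s n} {t n} 0<B 0<C
        (hB m (ℕ.m⊔n≤o⇒m≤o K L m≥KL))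
        (hC n (ℕ.m⊔n≤o⇒n≤o K L n≥KL))
        (hM m n (ℕ.m⊔n≤o⇒m≤o M N m≥MN) (ℕ.m⊔n≤o⇒m≤o M N n≥MN))
        (hN m n (ℕ.m⊔n≤o⇒n≤o M N m≥MN) (ℕ.m⊔n≤o⇒n≤o M N n≥MN)))

fromℚ : ℚ → ℝ
fromℚ q = mkℝ (λ _ → q) (const-cauchy q)

fromℤ : ℤ → ℝ
fromℤ z = fromℚ (z ℚ./ 1)

0ℝ 1ℝ : ℝ
0ℝ = fromℚ 0ℚ
1ℝ = fromℚ 1ℚ

infixl 6 _+_
infixl 7 _*_

_+_ : ℝ → ℝ → ℝ
x + y = mkℝ (λ n → seq x n ℚ.+ seq y n) (+-cauchy (seq x) (seq y) (cauchy x) (cauchy y))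

_*_ : ℝ → ℝ → ℝ
x * y = mkℝ (λ n → seq x n ℚ.* seq y n) (*-cauchy (seq x) (seq y) (cauchy x) (cauchy y))

sum : ∀ {n} → Vector ℝ n → ℝ
sum = Vector.foldr _+_ 0ℝ

infix 4 _≈ᵛ_

_≈ᵛ_ : ∀ {n} → Vector ℝ n → Vector ℝ n → Set
x ≈ᵛ y = ∀ i → x i ≈ y i

infix 8 _·_

_·_ : ∀ {n} → Vector ℝ n → Vector ℝ n → ℝ
c · x = sum (λ i → c i * x i)

embed : ∀ {n} → Vector ℕ n → Vector ℝ n
embed a i = fromℤ (+ a i)

-- Subsets of ℝⁿ are predicates; x is a convex combination, with weights w,
-- of finitely many points p j of A.
ConvexHull : ∀ {n} → (Vector ℝ n → Set) → (Vector ℝ n → Set)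
ConvexHull {n} A x =
  Σ ℕ λ m → Σ (Vector ℝ m) λ w → Σ (Vector (Vector ℝ n) m) λ p →
    (∀ j → 0ℝ ≤ w j) × sum w ≈ 1ℝ × (∀ j → A (p j)) ×
    (∀ i → x i ≈ sum (λ j → w j * p j i))

-- F is the intersection of P with { y | c · y = b } for some linear
-- inequality c · y ≤ b that is valid on P.
IsFace : ∀ {n} → (Vector ℝ n → Set) → (Vector ℝ n → Set) → Set
IsFace {n} P F = Σ (Vector ℝ n) λ c → Σ ℝ λ b →
  (∀ y → P y → c · y ≤ b) × (∀ y → F y ⇔ (P y × c · y ≈ b))

-- A 0-dimensional face is a face consisting of a single point.
IsVertex : ∀ {n} → (Vector ℝ n → Set) → (Vector ℝ n → Set)
IsVertex P x = IsFace P (λ y → y ≈ᵛ x)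

-- a ∘ σ is the weakly increasing rearrangement of a.  Positions are counted
-- from 0, so the bound on the entry at position i is suc (toℕ i).
record IsParkingFunction {n} (a : Vector ℕ n) : Set where
  field
    inRange    : ∀ i → 1 ℕ.≤ a i × a i ℕ.≤ n
    σ          : Permutation′ n
    increasing : ∀ i j → toℕ i ℕ.≤ toℕ j → a (σ ⟨$⟩ʳ i) ℕ.≤ a (σ ⟨$⟩ʳ j)
    below      : ∀ i → a (σ ⟨$⟩ʳ i) ℕ.≤ suc (toℕ i)

𝒫 : ∀ n → Vector ℝ n → Set
𝒫 n = ConvexHull λ x → Σ (Vector ℕ n) λ a → IsParkingFunction a × x ≈ᵛ embed a

𝒫-slice : ∀ n → ℤ → Vector ℝ n → Set
𝒫-slice n S x = 𝒫 n x × sum x ≈ fromℤ S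

-- The vector (1, …, 1, r, k + 2, k + 3, …, n) with k leading ones.
vertexVector : ∀ n → (r k : ℕ) → Vector ℕ n
vertexVector n r k i =
  if toℕ i <ᵇ k then 1 else if toℕ i ≡ᵇ k then r else suc (toℕ i)

-- When k ≤ n ∸ 1 the entries of vertexVector n r k are exactly the
-- summands of 1 + … + 1 + r + (k + 2) + … + n.
AdmissiblePair : ∀ n → ℤ → ℕ × ℕ → Set
AdmissiblePair n S (r , k) =
  1 ℕ.≤ r × 1 ℕ.≤ k × k ℕ.≤ n ∸ 1 × 2 ℕ.≤ r × r ℕ.≤ k ℕ.+ 1 ×
  + Vector.foldr ℕ._+_ 0 (vertexVector n r k) ≡ S

IsRearrangementOf : ∀ {n} → Vector ℕ n → Vector ℝ n → Set
IsRearrangementOf {n} a x =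
  Σ (Permutation′ n) λ σ → x ≈ᵛ embed (a ∘ (σ ⟨$⟩ʳ_))

{-# OPTIONS --safe #-}
module Submission where

-- For a parking function a and each l, the tail sum a_l + … + a_n is at most
-- l + … + n, and all entries are at least 1.  Hence on the slice every tail sum,
-- for every order of the coordinates, is at most the tail sum of the vector
-- v = (1, …, 1, r, k + 2, …, n).  If the coefficients of c increase, Abel
-- summation gives c · y ≤ c · v on the slice.  So a linear functional is
-- maximised at a rearrangement of v, which must be the vertex if the face is a
-- point; sorting the coefficients is only possible up to double negation, which
-- is harmless since the rearrangements of v are finitely many integer points.
-- Conversely Σ i y_i is the sum of all tail sums, so it is maximised by v alone.

-- A point of the slice is a convex combination of parking functions whose own sums may differ from
-- `S`, so a bound proved only for parking functions of sum `S` would not reach it. The tail bound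
-- is therefore put as an affine inequality valid at every parking function, if necessary with the
-- sum of the function as one of its terms; it passes to the combination, and only there is the sum
-- set to `S`. The vector for `S = n` is all ones and obeys the same tail bounds, so one argument
-- serves both halves of the theorem. The pair `(r, k)` is found by counting upwards from that
-- vector: `r` grows by one until it reaches `k + 1`, and then the number of ones drops.

-- Cauchy reals: order, arithmetic and stability under double negation.

module RealField where
  open import Algebra.Bundles using (CommutativeSemiring)
  open import Algebra.Structures using (IsCommutativeSemiring)
  open import Data.Nat.Base as ℕ using (ℕ)
  import Data.Integer.Base as ℤ
  import Data.Integer.Properties as ℤ
  import Data.Nat.Properties as ℕ
  open import Data.Product.Base using (∃; _×_; _,_)
  open import Data.Rational.Base as ℚ using (ℚ; 0ℚ; 1ℚ; ∣_∣)
  import Data.Rational.Properties as ℚ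
  import Data.Rational.Unnormalised.Base as ℚᵘ
  import Data.Rational.Unnormalised.Properties as ℚᵘ
  open import Data.Rational.Solver using (module +-*-Solver)
  open import Data.Sum.Base using (_⊎_; inj₁; inj₂)
  import Defs
  open import Defs hiding (_+_; _*_)
  open import Level using (0ℓ)
  open import Relation.Binary.Bundles using (Poset)
  open import Relation.Binary.PropositionalEquality as ≡ using (_≡_)
  open import Relation.Binary.Structures using (IsEquivalence)
  open import Relation.Nullary using (¬_; Dec; yes; no; contradiction)
  open +-*-Solver

  Eventually : (ℕ → Set) → Set
  Eventually P = ∃ λ N → ∀ n → N ℕ.≤ n → P n

  map-ev : ∀ {P Q} → (∀ n → P n → Q n) → Eventually P → Eventually Q
  map-ev f (N , h) = N , λ n N≤n → f n (h n N≤n)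

  both-ev : ∀ {P Q} → Eventually P → Eventually Q → Eventually (λ n → P n × Q n)
  both-ev (M , h) (N , k) = M ℕ.⊔ N , λ n le →
    h n (ℕ.m⊔n≤o⇒m≤o M N le) , k n (ℕ.m⊔n≤o⇒n≤o M N le)

  halve : ∀ ε → 0ℚ ℚ.< ε → ∃ λ δ → 0ℚ ℚ.< δ × δ ℚ.+ δ ≡ ε
  halve ε 0<ε with δ , 0<δ , 2δ≡ε ← quotient ε (1ℚ ℚ.+ 1ℚ) 0<ε (0<+ 0<1 0<1) =
    δ , 0<δ , ≡.trans (solve 1 (λ d → d :+ d := (con 1ℚ :+ con 1ℚ) :* d) ≡.refl δ) 2δ≡ε

  -- Most estimates below add two errors of size `δ`; stating the goal at `δ + δ` leaves only a
  -- linear identity to check.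
  halving : (P : ℚ → Set) → (∀ δ → 0ℚ ℚ.< δ → P (δ ℚ.+ δ)) → ∀ ε → 0ℚ ℚ.< ε → P ε
  halving P h ε 0<ε = let δ , 0<δ , 2δ≡ε = halve ε 0<ε in ≡.subst P 2δ≡ε (h δ 0<δ)

  -- The equation says `r - s = p - q`. An inequality between rationals is thus reduced to a known
  -- one plus an identity for the ring solver.
  ≤-shift : ∀ {p q r s} → p ℚ.≤ q → r ℚ.+ q ≡ p ℚ.+ s → r ℚ.≤ s
  ≤-shift {p} {q} {r} {s} p≤q eq = begin
    r                     ≡⟨ solve 2 (λ q r → r := (r :+ q) :- q) ≡.refl q r ⟩
    (r ℚ.+ q) ℚ.- q       ≡⟨ ≡.cong (ℚ._- q) eq ⟩
    (p ℚ.+ s) ℚ.- q       ≤⟨ ℚ.+-monoˡ-≤ (ℚ.- q) (ℚ.+-monoˡ-≤ s p≤q) ⟩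
    (q ℚ.+ s) ℚ.- q       ≡⟨ solve 2 (λ q s → (q :+ s) :- q := s) ≡.refl q s ⟩
    s                     ∎
    where open ℚ.≤-Reasoning

  <-shift : ∀ {p q r s} → p ℚ.< q → r ℚ.+ q ≡ p ℚ.+ s → r ℚ.< s
  <-shift {p} {q} {r} {s} p<q eq = begin-strict
    r                     ≡⟨ solve 2 (λ q r → r := (r :+ q) :- q) ≡.refl q r ⟩
    (r ℚ.+ q) ℚ.- q       ≡⟨ ≡.cong (ℚ._- q) eq ⟩
    (p ℚ.+ s) ℚ.- q       <⟨ ℚ.+-monoˡ-< (ℚ.- q) (ℚ.+-monoˡ-< s p<q) ⟩
    (q ℚ.+ s) ℚ.- q       ≡⟨ solve 2 (λ q s → (q :+ s) :- q := s) ≡.refl q s ⟩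
    s                     ∎
    where open ℚ.≤-Reasoning

  p≤∣p∣ : ∀ p → p ℚ.≤ ∣ p ∣
  p≤∣p∣ p with ℚ.≤-total 0ℚ p
  ... | inj₁ 0≤p = ℚ.≤-reflexive (≡.sym (ℚ.0≤p⇒∣p∣≡p 0≤p))
  ... | inj₂ p≤0 = ℚ.≤-trans p≤0 (ℚ.0≤∣p∣ p)

  -p≤∣p∣ : ∀ p → ℚ.- p ℚ.≤ ∣ p ∣
  -p≤∣p∣ p = ≡.subst (ℚ.- p ℚ.≤_) (ℚ.∣-p∣≡∣p∣ p) (p≤∣p∣ (ℚ.- p))

  ∣-∣<⇒< : ∀ p q {ε} → ∣ p ℚ.- q ∣ ℚ.< ε → p ℚ.< q ℚ.+ ε
  ∣-∣<⇒< p q {ε} h = <-shift (ℚ.≤-<-trans (p≤∣p∣ (p ℚ.- q)) h)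
    (solve 3 (λ p q e → p :+ e := (p :- q) :+ (q :+ e)) ≡.refl p q ε)

  ∣-∣<⇒<′ : ∀ p q {ε} → ∣ p ℚ.- q ∣ ℚ.< ε → q ℚ.< p ℚ.+ ε
  ∣-∣<⇒<′ p q {ε} h = <-shift (ℚ.≤-<-trans (-p≤∣p∣ (p ℚ.- q)) h)
    (solve 3 (λ p q e → q :+ e := (:- (p :- q)) :+ (p :+ e)) ≡.refl p q ε)

  <⇒∣-∣< : ∀ p q {ε} → p ℚ.< q ℚ.+ ε → q ℚ.< p ℚ.+ ε → ∣ p ℚ.- q ∣ ℚ.< ε
  <⇒∣-∣< p q {ε} p< q< with ℚ.∣p∣≡p∨∣p∣≡-p (p ℚ.- q)
  ... | inj₁ eq = ≡.subst (ℚ._< ε) (≡.sym eq) (<-shift p<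
    (solve 3 (λ p q e → (p :- q) :+ (q :+ e) := p :+ e) ≡.refl p q ε))
  ... | inj₂ eq = ≡.subst (ℚ._< ε) (≡.sym eq) (<-shift q<
    (solve 3 (λ p q e → (:- (p :- q)) :+ (p :+ e) := q :+ e) ≡.refl p q ε))

  p<p+ε : ∀ p {ε} → 0ℚ ℚ.< ε → p ℚ.< p ℚ.+ ε
  p<p+ε p {ε} 0<ε = <-shift 0<ε (solve 2 (λ p e → p :+ e := con 0ℚ :+ (p :+ e)) ≡.refl p ε)

  -- Unlike the bare definitions, these records do not unfold, so that the
  -- related numbers can be inferred from the type of a proof.
  infix 4 _≃_ _≼_

  record _≃_ (x y : ℝ) : Set where
    constructor mk≃
    field get≃ : x ≈ y

  record _≼_ (x y : ℝ) : Set where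
    constructor mk≼
    field get≼ : x ≤ y

  open _≃_ public
  open _≼_ public

  ≤-reflexive : ∀ {x y} → x ≃ y → x ≼ y
  ≤-reflexive {x} {y} (mk≃ x≈y) = mk≼ λ ε 0<ε →
    map-ev (λ n h → ℚ.<⇒≤ (∣-∣<⇒< (seq x n) (seq y n) h)) (x≈y ε 0<ε)

  ≤-reflexive′ : ∀ {x y} → x ≃ y → y ≼ x
  ≤-reflexive′ {x} {y} (mk≃ x≈y) = mk≼ λ ε 0<ε →
    map-ev (λ n h → ℚ.<⇒≤ (∣-∣<⇒<′ (seq x n) (seq y n) h)) (x≈y ε 0<ε)

  ≤-antisym : ∀ {x y} → x ≼ y → y ≼ x → x ≃ y
  ≤-antisym {x} {y} (mk≼ x≤y) (mk≼ y≤x) = mk≃ (halving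
    (λ ε → Eventually λ n → ∣ seq x n ℚ.- seq y n ∣ ℚ.< ε)
    λ δ 0<δ → map-ev (λ n (h , k) → <⇒∣-∣< (seq x n) (seq y n)
      (ℚ.≤-<-trans h (ℚ.+-monoʳ-< (seq y n) (p<p+ε δ 0<δ)))
      (ℚ.≤-<-trans k (ℚ.+-monoʳ-< (seq x n) (p<p+ε δ 0<δ))))
      (both-ev (x≤y δ 0<δ) (y≤x δ 0<δ)))

  pointwise : ∀ {x y} → (∀ n → seq x n ≡ seq y n) → x ≃ y
  pointwise {x} {y} h = mk≃ λ ε 0<ε → 0 , λ n _ →
    ≡.subst (λ q → ∣ seq x n ℚ.- q ∣ ℚ.< ε) (h n)
      (≡.subst (λ d → ∣ d ∣ ℚ.< ε) (≡.sym (ℚ.+-inverseʳ (seq x n))) 0<ε)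

  pointwise-≤ : ∀ {x y} → (∀ n → seq x n ℚ.≤ seq y n) → x ≼ y
  pointwise-≤ {x} {y} h = mk≼ λ ε 0<ε → 0 , λ n _ →
    ℚ.≤-trans (h n) (ℚ.<⇒≤ (p<p+ε (seq y n) 0<ε))

  ≤-trans : ∀ {x y z} → x ≼ y → y ≼ z → x ≼ z
  ≤-trans {x} {y} {z} (mk≼ x≤y) (mk≼ y≤z) = mk≼ (halving
    (λ ε → Eventually λ n → seq x n ℚ.≤ seq z n ℚ.+ ε)
    λ δ 0<δ → map-ev (λ n (h , k) → ≤-shift (ℚ.+-mono-≤ h k)
      (solve 4 (λ x y z d → x :+ ((y :+ d) :+ (z :+ d)) := (x :+ y) :+ (z :+ (d :+ d)))
        ≡.refl (seq x n) (seq y n) (seq z n) δ))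
      (both-ev (x≤y δ 0<δ) (y≤z δ 0<δ)))

  ≈-isEquivalence : IsEquivalence _≃_
  ≈-isEquivalence = record
    { refl  = pointwise λ _ → ≡.refl
    ; sym   = λ x≈y → ≤-antisym (≤-reflexive′ x≈y) (≤-reflexive x≈y)
    ; trans = λ x≈y y≈z → ≤-antisym
        (≤-trans (≤-reflexive x≈y) (≤-reflexive y≈z))
        (≤-trans (≤-reflexive′ y≈z) (≤-reflexive′ x≈y))
    }

  ≤-poset : Poset 0ℓ 0ℓ 0ℓ
  ≤-poset = record
    { isPartialOrder = record
      { isPreorder = record
        { isEquivalence = ≈-isEquivalence
        ; reflexive     = ≤-reflexive
        ; trans         = ≤-trans
        }
      ; antisym = ≤-antisym
      }
    }

  open Poset ≤-poset public
    using () renaming (refl to ≤-refl; module Eq to ≈)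

  infixl 6 _+_ _-_
  infixl 7 _*_

  -- Opaque, because comparing sums and products of reals by unfolding them
  -- compares their proofs of being Cauchy sequences.
  opaque
    _+_ _*_ _-_ : ℝ → ℝ → ℝ
    x + y = x Defs.+ y
    x * y = x Defs.* y
    x - y = x + fromℚ (ℚ.- 1ℚ) * y

    +-def : ∀ x y → x Defs.+ y ≃ x + y
    +-def x y = pointwise λ _ → ≡.refl

    *-def : ∀ x y → x Defs.* y ≃ x * y
    *-def x y = pointwise λ _ → ≡.refl

    +-mono-≤ : ∀ {x y u v} → x ≼ y → u ≼ v → x + u ≼ y + v
    +-mono-≤ {x} {y} {u} {v} (mk≼ x≤y) (mk≼ u≤v) = mk≼ (halving
      (λ ε → Eventually λ n → seq x n ℚ.+ seq u n ℚ.≤ (seq y n ℚ.+ seq v n) ℚ.+ ε)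
      λ δ 0<δ → map-ev (λ n (h , k) → ≤-shift (ℚ.+-mono-≤ h k)
        (solve 5 (λ x y u v d → (x :+ u) :+ ((y :+ d) :+ (v :+ d))
          := (x :+ u) :+ ((y :+ v) :+ (d :+ d)))
          ≡.refl (seq x n) (seq y n) (seq u n) (seq v n) δ))
        (both-ev (x≤y δ 0<δ) (u≤v δ 0<δ)))

    +-cong : ∀ {x y u v} → x ≃ y → u ≃ v → x + u ≃ y + v
    +-cong x≈y u≈v = ≤-antisym
      (+-mono-≤ (≤-reflexive x≈y) (≤-reflexive u≈v))
      (+-mono-≤ (≤-reflexive′ x≈y) (≤-reflexive′ u≈v))

    *-cong : ∀ {x y u v} → x ≃ y → u ≃ v → x * u ≃ y * v
    *-cong {x} {y} {u} {v} (mk≃ x≈y) (mk≃ u≈v) = mk≃ λ ε 0<ε →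
      let B , 0<B , hB = bounded (seq x) (cauchy x)
          C , 0<C , hC = bounded (seq v) (cauchy v)
          δ , 0<δ , Dδ≡ε = quotient ε (B ℚ.+ C) 0<ε (0<+ 0<B 0<C)
      in map-ev
        (λ n ((b , c) , (h , k)) →
          ≡.subst (∣ seq x n ℚ.* seq u n ℚ.- seq y n ℚ.* seq v n ∣ ℚ.<_) Dδ≡ε
            (*-close {seq x n} {seq u n} {seq y n} {seq v n} 0<B 0<C b c h k))
        (both-ev (both-ev hB hC) (both-ev (x≈y δ 0<δ) (u≈v δ 0<δ)))

    +-*-isCommutativeSemiring : IsCommutativeSemiring _≃_ _+_ _*_ 0ℝ 1ℝ
    +-*-isCommutativeSemiring = record
      { isSemiring = record
        { isSemiringWithoutAnnihilatingZero = record
          { +-isCommutativeMonoid = record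
            { isMonoid = record
              { isSemigroup = record
                { isMagma = record { isEquivalence = ≈-isEquivalence ; ∙-cong = +-cong }
                ; assoc   = λ x y z → pointwise λ n → ℚ.+-assoc (seq x n) (seq y n) (seq z n)
                }
              ; identity = (λ x → pointwise λ n → ℚ.+-identityˡ (seq x n))
                         , (λ x → pointwise λ n → ℚ.+-identityʳ (seq x n))
              }
            ; comm = λ x y → pointwise λ n → ℚ.+-comm (seq x n) (seq y n)
            }
          ; *-cong     = *-cong
          ; *-assoc    = λ x y z → pointwise λ n → ℚ.*-assoc (seq x n) (seq y n) (seq z n)
          ; *-identity = (λ x → pointwise λ n → ℚ.*-identityˡ (seq x n))
                       , (λ x → pointwise λ n → ℚ.*-identityʳ (seq x n))
          ; distrib    = (λ x y z → pointwise λ n → ℚ.*-distribˡ-+ (seq x n) (seq y n) (seq z n))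
                       , (λ x y z → pointwise λ n → ℚ.*-distribʳ-+ (seq x n) (seq y n) (seq z n))
          }
        ; zero = (λ x → pointwise λ n → ℚ.*-zeroˡ (seq x n))
               , (λ x → pointwise λ n → ℚ.*-zeroʳ (seq x n))
        }
      ; *-comm = λ x y → pointwise λ n → ℚ.*-comm (seq x n) (seq y n)
      }

    +-cancelʳ-≤ : ∀ {x y} z → x + z ≼ y + z → x ≼ y
    +-cancelʳ-≤ {x} {y} z (mk≼ h) = mk≼ λ ε 0<ε → map-ev
      (λ n k → ≤-shift k (solve 4 (λ x y z e → x :+ ((y :+ z) :+ e) := (x :+ z) :+ (y :+ e))
        ≡.refl (seq x n) (seq y n) (seq z n) ε))
      (h ε 0<ε)

    x≤y⇒0≤y-x : ∀ {x y} → x ≼ y → 0ℝ ≼ y - x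
    x≤y⇒0≤y-x {x} {y} x≤y = +-cancelʳ-≤ x (≤-trans
      (≤-reflexive (pointwise λ n → ℚ.+-identityˡ (seq x n)))
      (≤-trans x≤y (≤-reflexive (pointwise λ n →
        solve 2 (λ x y → y := (y :+ con (ℚ.- 1ℚ) :* x) :+ x) ≡.refl (seq x n) (seq y n)))))

    *-nonNegative : ∀ {x y} → 0ℝ ≼ x → 0ℝ ≼ y → 0ℝ ≼ x * y
    *-nonNegative {x} {y} (mk≼ 0≤x) (mk≼ 0≤y) = mk≼ λ ε 0<ε →
      let B , 0<B , hB = bounded (seq x) (cauchy x)
          C , 0<C , hC = bounded (seq y) (cauchy y)
          -- The error in `(p + δ) * (q + δ)` is `(p + q + δ) * δ`. Here `B + C` bounds `p + q` and
          -- `1` bounds `δ`; the summand `ε` makes `D` at least `ε`, which is what gives `δ ≤ 1`.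
          D = ((B ℚ.+ C) ℚ.+ 1ℚ) ℚ.+ ε
          0<D = 0<+ (0<+ (0<+ 0<B 0<C) 0<1) 0<ε
          δ , 0<δ , Dδ≡ε = quotient ε D 0<ε 0<D
      in map-ev
        (λ n ((b , c) , (h , k)) → bound ε 0<ε (seq x n) (seq y n) B C δ 0<B 0<C 0<δ Dδ≡ε b c h k)
        (both-ev (both-ev hB hC) (both-ev (0≤x δ 0<δ) (0≤y δ 0<δ)))
      where
      bound : ∀ ε → 0ℚ ℚ.< ε → ∀ p q B C δ → 0ℚ ℚ.< B → 0ℚ ℚ.< C → 0ℚ ℚ.< δ →
              (((B ℚ.+ C) ℚ.+ 1ℚ) ℚ.+ ε) ℚ.* δ ≡ ε →
              ∣ p ∣ ℚ.≤ B → ∣ q ∣ ℚ.≤ C → 0ℚ ℚ.≤ p ℚ.+ δ → 0ℚ ℚ.≤ q ℚ.+ δ →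
              0ℚ ℚ.≤ p ℚ.* q ℚ.+ ε
      bound ε 0<ε p q B C δ 0<B 0<C 0<δ Dδ≡ε p≤B q≤C h k = begin
        0ℚ
          ≤⟨ ℚ.nonNegative⁻¹ _ {{ℚ.nonNeg*nonNeg⇒nonNeg (p ℚ.+ δ) {{ℚ.nonNegative h}} (q ℚ.+ δ) {{ℚ.nonNegative k}}}} ⟩
        (p ℚ.+ δ) ℚ.* (q ℚ.+ δ)
          ≡⟨ solve 3 (λ p q d → (p :+ d) :* (q :+ d) := p :* q :+ ((p :+ q) :+ d) :* d) ≡.refl p q δ ⟩
        p ℚ.* q ℚ.+ ((p ℚ.+ q) ℚ.+ δ) ℚ.* δ
          ≤⟨ ℚ.+-monoʳ-≤ (p ℚ.* q) (ℚ.*-monoʳ-≤-nonNeg δ {{δ≥0}}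
               (ℚ.+-mono-≤ (ℚ.+-mono-≤ (ℚ.≤-trans (p≤∣p∣ p) p≤B) (ℚ.≤-trans (p≤∣p∣ q) q≤C)) δ≤1)) ⟩
        p ℚ.* q ℚ.+ ((B ℚ.+ C) ℚ.+ 1ℚ) ℚ.* δ
          ≤⟨ ℚ.+-monoʳ-≤ (p ℚ.* q) (ℚ.*-monoʳ-≤-nonNeg δ {{δ≥0}} (ℚ.<⇒≤ (p<p+ε ((B ℚ.+ C) ℚ.+ 1ℚ) 0<ε))) ⟩
        p ℚ.* q ℚ.+ D ℚ.* δ
          ≡⟨ ≡.cong (p ℚ.* q ℚ.+_) Dδ≡ε ⟩
        p ℚ.* q ℚ.+ ε ∎
        where
        open ℚ.≤-Reasoning
        D : ℚ
        D = ((B ℚ.+ C) ℚ.+ 1ℚ) ℚ.+ ε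
        0≤B+C+1 : 0ℚ ℚ.≤ (B ℚ.+ C) ℚ.+ 1ℚ
        0≤B+C+1 = ℚ.<⇒≤ (0<+ (0<+ 0<B 0<C) 0<1)
        δ≥0 : ℚ.NonNegative δ
        δ≥0 = ℚ.nonNegative (ℚ.<⇒≤ 0<δ)
        δ≤1 : δ ℚ.≤ 1ℚ
        δ≤1 = ℚ.*-cancelˡ-≤-pos D {{ℚ.positive (0<+ (0<+ (0<+ 0<B 0<C) 0<1) 0<ε)}} (begin
          D ℚ.* δ    ≡⟨ Dδ≡ε ⟩
          ε          ≤⟨ ≤-shift 0≤B+C+1 (solve 2 (λ s e → e :+ s := con 0ℚ :+ (s :+ e)) ≡.refl ((B ℚ.+ C) ℚ.+ 1ℚ) ε) ⟩
          D          ≡⟨ ℚ.*-identityʳ D ⟨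
          D ℚ.* 1ℚ   ∎)

    -- This is `0 ≤ (b - a) * (q - p)` expanded and freed of subtraction, so that it can be an axiom
    -- of an ordered semiring.
    rearrangement : ∀ {a b p q} → a ≼ b → p ≼ q → a * q + b * p ≼ a * p + b * q
    rearrangement {a} {b} {p} {q} a≤b p≤q = ≤-trans
      (≤-reflexive (pointwise λ n → ≡.sym (ℚ.+-identityˡ (seq (a * q + b * p) n))))
      (≤-trans
        (+-mono-≤ (*-nonNegative (x≤y⇒0≤y-x a≤b) (x≤y⇒0≤y-x p≤q)) (≤-refl {a * q + b * p}))
        (≤-reflexive (pointwise λ n → solve 4 (λ a b p q →
          (b :+ con (ℚ.- 1ℚ) :* a) :* (q :+ con (ℚ.- 1ℚ) :* p) :+ (a :* q :+ b :* p)
            := a :* p :+ b :* q) ≡.refl (seq a n) (seq b n) (seq p n) (seq q n))))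

  +-*-commutativeSemiring : CommutativeSemiring 0ℓ 0ℓ
  +-*-commutativeSemiring = record { isCommutativeSemiring = +-*-isCommutativeSemiring }

  -- The constructive substitute for comparing reals. Beyond some `N` the difference `x - y` moves
  -- by less than `η`, half of `δ`, so the decidable comparison of the rationals at `N` with slack
  -- `δ` settles all later terms: either `x` exceeds `y` by at most `3 η`, or by at least `η`.
  locate : ∀ x y ε → 0ℚ ℚ.< ε →
    Eventually (λ n → seq x n ℚ.≤ seq y n ℚ.+ ε) ⊎
    (∃ λ η → 0ℚ ℚ.< η × Eventually (λ n → seq y n ℚ.+ η ℚ.≤ seq x n))
  locate x y = halving
    (λ ε → Eventually (λ n → seq x n ℚ.≤ seq y n ℚ.+ ε) ⊎
      (∃ λ η → 0ℚ ℚ.< η × Eventually (λ n → seq y n ℚ.+ η ℚ.≤ seq x n)))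
    λ δ 0<δ → let η , 0<η , 2η≡δ = halve δ 0<δ
                  N , h = +-cauchy (seq x) (seq -y) (cauchy x) (cauchy -y) η 0<η
              in compare δ η 0<η 2η≡δ N (λ n N≤n → h n N N≤n ℕ.≤-refl) (seq x N ℚ.≤? seq y N ℚ.+ δ)
    where
    -y : ℝ
    -y = fromℚ (ℚ.- 1ℚ) Defs.* y
    compare : ∀ δ η → 0ℚ ℚ.< η → η ℚ.+ η ≡ δ → ∀ N →
      (∀ n → N ℕ.≤ n → ∣ (seq x n ℚ.+ seq -y n) ℚ.- (seq x N ℚ.+ seq -y N) ∣ ℚ.< η) →
      Dec (seq x N ℚ.≤ seq y N ℚ.+ δ) →
      Eventually (λ n → seq x n ℚ.≤ seq y n ℚ.+ (δ ℚ.+ δ)) ⊎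
      (∃ λ η → 0ℚ ℚ.< η × Eventually (λ n → seq y n ℚ.+ η ℚ.≤ seq x n))
    compare δ η 0<η ≡.refl N h (yes le) = inj₁ (N , λ n N≤n → ℚ.≤-trans (≤-shift
      (ℚ.+-mono-≤ le (ℚ.<⇒≤ (∣-∣<⇒< (seq x n ℚ.+ seq -y n) (seq x N ℚ.+ seq -y N) (h n N≤n))))
      (solve 5 (λ xN yN x y e → x :+ ((yN :+ (e :+ e)) :+ ((xN :+ con (ℚ.- 1ℚ) :* yN) :+ e))
        := (xN :+ (x :+ con (ℚ.- 1ℚ) :* y)) :+ (y :+ (e :+ e :+ e)))
        ≡.refl (seq x N) (seq y N) (seq x n) (seq y n) η))
      (ℚ.+-monoʳ-≤ (seq y n) (≤-shift (ℚ.<⇒≤ 0<η)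
        (solve 1 (λ e → (e :+ e :+ e) :+ e := con 0ℚ :+ ((e :+ e) :+ (e :+ e))) ≡.refl η))))
    compare δ η 0<η ≡.refl N h (no ≰) = inj₂ (η , 0<η , N , λ n N≤n → ≤-shift
      (ℚ.+-mono-≤ (ℚ.<⇒≤ (ℚ.≰⇒> ≰))
        (ℚ.<⇒≤ (∣-∣<⇒<′ (seq x n ℚ.+ seq -y n) (seq x N ℚ.+ seq -y N) (h n N≤n))))
      (solve 5 (λ xN yN x y e → (y :+ e) :+ (xN :+ ((x :+ con (ℚ.- 1ℚ) :* y) :+ e))
        := ((yN :+ (e :+ e)) :+ (xN :+ con (ℚ.- 1ℚ) :* yN)) :+ x)
        ≡.refl (seq x N) (seq y N) (seq x n) (seq y n) η))

  apart⇒≰ : ∀ {x y} η → 0ℚ ℚ.< η → Eventually (λ n → seq y n ℚ.+ η ℚ.≤ seq x n) → ¬ x ≼ y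
  apart⇒≰ {x} {y} η 0<η gap (mk≼ x≤y) =
    let δ , 0<δ , 2δ≡η = halve η 0<η
        N , h = both-ev gap (x≤y δ 0<δ)
        y+η≤x , x≤y+δ = h N ℕ.≤-refl
    in ℚ.<-irrefl ≡.refl (ℚ.<-≤-trans 0<δ (≤-shift (ℚ.≤-trans y+η≤x x≤y+δ)
         (≡.trans (solve 2 (λ y d → d :+ (y :+ d) := y :+ (d :+ d)) ≡.refl (seq y N) δ)
           (≡.trans (≡.cong (seq y N ℚ.+_) 2δ≡η) (≡.sym (ℚ.+-identityʳ (seq y N ℚ.+ η)))))))

  -- For each `ε` the alternative to the wanted bound is a positive gap, which refutes `x ≼ y`
  -- outright and so is excluded by the double negation.
  ≤-stable : ∀ {x y} → ¬ ¬ x ≼ y → x ≼ y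
  ≤-stable {x} {y} ¬¬x≤y = mk≼ λ ε 0<ε → case ε (locate x y ε 0<ε)
    where
    case : ∀ ε → Eventually (λ n → seq x n ℚ.≤ seq y n ℚ.+ ε) ⊎
      (∃ λ η → 0ℚ ℚ.< η × Eventually (λ n → seq y n ℚ.+ η ℚ.≤ seq x n)) →
      Eventually (λ n → seq x n ℚ.≤ seq y n ℚ.+ ε)
    case ε (inj₁ le) = le
    case ε (inj₂ (η , 0<η , gap)) = contradiction (apart⇒≰ η 0<η gap) ¬¬x≤y

  ≈-stable : ∀ {x y} → ¬ ¬ x ≃ y → x ≃ y
  ≈-stable h = ≤-antisym
    (≤-stable λ k → h λ eq → k (≤-reflexive eq))
    (≤-stable λ k → h λ eq → k (≤-reflexive′ eq))

  ≰⇒≥ : ∀ {x y} → ¬ x ≼ y → y ≼ x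
  ≰⇒≥ {x} {y} x≰y = mk≼ λ ε 0<ε → case ε (locate y x ε 0<ε)
    where
    case : ∀ ε → Eventually (λ n → seq y n ℚ.≤ seq x n ℚ.+ ε) ⊎
      (∃ λ η → 0ℚ ℚ.< η × Eventually (λ n → seq x n ℚ.+ η ℚ.≤ seq y n)) →
      Eventually (λ n → seq y n ℚ.≤ seq x n ℚ.+ ε)
    case ε (inj₁ le) = le
    case ε (inj₂ (η , 0<η , gap)) = contradiction
      (mk≼ λ ε′ 0<ε′ → map-ev (λ n x+η≤y → ℚ.≤-trans (ℚ.<⇒≤ (p<p+ε (seq x n) 0<η))
        (ℚ.≤-trans x+η≤y (ℚ.<⇒≤ (p<p+ε (seq y n) 0<ε′)))) gap)
      x≰y

  -- The naturals inside the reals.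

  fromℕ : ℕ → ℝ
  fromℕ n = fromℤ (ℤ.+ n)

  private
    toℚᵘ-/1 : ∀ i → ℚ.toℚᵘ (i ℚ./ 1) ℚᵘ.≃ ℚᵘ.mkℚᵘ i 0
    toℚᵘ-/1 i = ℚ.toℚᵘ-fromℚᵘ (ℚᵘ.mkℚᵘ i 0)

  -- `i / 1` is normalised by a gcd that does not compute for a variable `i`. In the unnormalised
  -- rationals it is the bare fraction, where the claim is an identity of integers.
  /1-+ : ∀ i j → (i ℤ.+ j) ℚ./ 1 ≡ i ℚ./ 1 ℚ.+ j ℚ./ 1
  /1-+ i j = ℚ.toℚᵘ-injective (begin
    ℚ.toℚᵘ ((i ℤ.+ j) ℚ./ 1)                  ≈⟨ toℚᵘ-/1 (i ℤ.+ j) ⟩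
    ℚᵘ.mkℚᵘ (i ℤ.+ j) 0                        ≈⟨ ℚᵘ.*≡* (≡.cong (ℤ._* ℤ.+ 1)
                                                    (≡.sym (≡.cong₂ ℤ._+_ (ℤ.*-identityʳ i) (ℤ.*-identityʳ j)))) ⟩
    ℚᵘ.mkℚᵘ i 0 ℚᵘ.+ ℚᵘ.mkℚᵘ j 0               ≈⟨ ℚᵘ.+-cong (toℚᵘ-/1 i) (toℚᵘ-/1 j) ⟨
    ℚ.toℚᵘ (i ℚ./ 1) ℚᵘ.+ ℚ.toℚᵘ (j ℚ./ 1)    ≈⟨ ℚ.toℚᵘ-homo-+ (i ℚ./ 1) (j ℚ./ 1) ⟨
    ℚ.toℚᵘ (i ℚ./ 1 ℚ.+ j ℚ./ 1)              ∎)
    where open ℚᵘ.≃-Reasoning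

  /1-* : ∀ i j → (i ℤ.* j) ℚ./ 1 ≡ (i ℚ./ 1) ℚ.* (j ℚ./ 1)
  /1-* i j = ℚ.toℚᵘ-injective (begin
    ℚ.toℚᵘ ((i ℤ.* j) ℚ./ 1)                  ≈⟨ toℚᵘ-/1 (i ℤ.* j) ⟩
    ℚᵘ.mkℚᵘ i 0 ℚᵘ.* ℚᵘ.mkℚᵘ j 0               ≈⟨ ℚᵘ.*-cong (toℚᵘ-/1 i) (toℚᵘ-/1 j) ⟨
    ℚ.toℚᵘ (i ℚ./ 1) ℚᵘ.* ℚ.toℚᵘ (j ℚ./ 1)    ≈⟨ ℚ.toℚᵘ-homo-* (i ℚ./ 1) (j ℚ./ 1) ⟨
    ℚ.toℚᵘ ((i ℚ./ 1) ℚ.* (j ℚ./ 1))          ∎)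
    where open ℚᵘ.≃-Reasoning

  /1-mono-≤ : ∀ {i j} → i ℤ.≤ j → i ℚ./ 1 ℚ.≤ j ℚ./ 1
  /1-mono-≤ {i} {j} i≤j = ℚ.toℚᵘ-cancel-≤ (begin
    ℚ.toℚᵘ (i ℚ./ 1)  ≃⟨ toℚᵘ-/1 i ⟩
    ℚᵘ.mkℚᵘ i 0       ≤⟨ ℚᵘ.*≤* (ℤ.*-monoʳ-≤-nonNeg (ℤ.+ 1) i≤j) ⟩
    ℚᵘ.mkℚᵘ j 0       ≃⟨ toℚᵘ-/1 j ⟨
    ℚ.toℚᵘ (j ℚ./ 1)  ∎)
    where open ℚᵘ.≤-Reasoning

  opaque
    unfolding _+_

    fromℕ-+ : ∀ m n → fromℕ (m ℕ.+ n) ≃ fromℕ m + fromℕ n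
    fromℕ-+ m n = pointwise λ _ → /1-+ (ℤ.+ m) (ℤ.+ n)

    fromℕ-* : ∀ m n → fromℕ (m ℕ.* n) ≃ fromℕ m * fromℕ n
    fromℕ-* m n = pointwise λ _ → ≡.trans (≡.cong (ℚ._/ 1) (ℤ.pos-* m n)) (/1-* (ℤ.+ m) (ℤ.+ n))

  fromℕ-mono-≤ : ∀ {m n} → m ℕ.≤ n → fromℕ m ≼ fromℕ n
  fromℕ-mono-≤ m≤n = pointwise-≤ λ _ → /1-mono-≤ (ℤ.+≤+ m≤n)

  -- Two different naturals are at distance at least 1.
  near-≤ : ∀ q {m n} → ∣ q ℚ.- ℤ.+ m ℚ./ 1 ∣ ℚ.< ℚ.½ → ∣ q ℚ.- ℤ.+ n ℚ./ 1 ∣ ℚ.< ℚ.½ → m ℕ.≤ n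
  near-≤ q {m} {n} hm hn = ℕ.≮⇒≥ λ n<m → ℚ.<-irrefl ≡.refl (begin-strict
    ℤ.+ m ℚ./ 1                  <⟨ ∣-∣<⇒<′ q (ℤ.+ m ℚ./ 1) hm ⟩
    q ℚ.+ ℚ.½                    <⟨ ℚ.+-monoˡ-< ℚ.½ (∣-∣<⇒< q (ℤ.+ n ℚ./ 1) hn) ⟩
    (ℤ.+ n ℚ./ 1 ℚ.+ ℚ.½) ℚ.+ ℚ.½  ≡⟨ solve 1 (λ x → (x :+ con ℚ.½) :+ con ℚ.½ := con 1ℚ :+ x) ≡.refl (ℤ.+ n ℚ./ 1) ⟩
    1ℚ ℚ.+ ℤ.+ n ℚ./ 1           ≡⟨ /1-+ (ℤ.+ 1) (ℤ.+ n) ⟨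
    ℤ.+ (ℕ.suc n) ℚ./ 1          ≤⟨ /1-mono-≤ (ℤ.+≤+ n<m) ⟩
    ℤ.+ m ℚ./ 1                  ∎)
    where open ℚ.≤-Reasoning

  near-unique : ∀ q {m n} → ∣ q ℚ.- ℤ.+ m ℚ./ 1 ∣ ℚ.< ℚ.½ → ∣ q ℚ.- ℤ.+ n ℚ./ 1 ∣ ℚ.< ℚ.½ → m ≡ n
  near-unique q hm hn = ℕ.≤-antisym (near-≤ q hm hn) (near-≤ q hn hm)

  -- Equality with a natural is undecidable, but q decides which natural x is
  -- if it is one at all.
  approximation : ∀ x → ∃ λ q → ∀ n → x ≃ fromℕ n → ∣ q ℚ.- ℤ.+ n ℚ./ 1 ∣ ℚ.< ℚ.½
  approximation x =
    let δ , 0<δ , 2δ≡½ = halve ℚ.½ (ℚ.positive⁻¹ ℚ.½)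
        N , h = cauchy x δ 0<δ
    in seq x N , λ n (mk≃ x≈n) → close δ 2δ≡½ N (λ k → h N k ℕ.≤-refl) n (x≈n δ 0<δ)
    where
    open ℚ.≤-Reasoning
    close : ∀ δ → δ ℚ.+ δ ≡ ℚ.½ → ∀ N → (∀ k → N ℕ.≤ k → ∣ seq x N ℚ.- seq x k ∣ ℚ.< δ) → ∀ n →
      Eventually (λ k → ∣ seq x k ℚ.- ℤ.+ n ℚ./ 1 ∣ ℚ.< δ) → ∣ seq x N ℚ.- ℤ.+ n ℚ./ 1 ∣ ℚ.< ℚ.½
    close δ 2δ≡½ N h n (M , k) = begin-strict
      ∣ seq x N ℚ.- q ∣
        ≡⟨ ≡.cong ∣_∣ (solve 3 (λ a b c → a :- c := (a :- b) :+ (b :- c)) ≡.refl (seq x N) (seq x L) q) ⟩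
      ∣ (seq x N ℚ.- seq x L) ℚ.+ (seq x L ℚ.- q) ∣
        ≤⟨ ℚ.∣p+q∣≤∣p∣+∣q∣ (seq x N ℚ.- seq x L) (seq x L ℚ.- q) ⟩
      ∣ seq x N ℚ.- seq x L ∣ ℚ.+ ∣ seq x L ℚ.- q ∣
        <⟨ ℚ.+-mono-< (h L (ℕ.m≤m⊔n N M)) (k L (ℕ.m≤n⊔m N M)) ⟩
      δ ℚ.+ δ ≡⟨ 2δ≡½ ⟩
      ℚ.½ ∎
      where
      L = N ℕ.⊔ M
      q = ℤ.+ n ℚ./ 1

-- Abel summation and convex combinations in an ordered semiring.

module Majorization where
  open import Algebra.Bundles using (CommutativeSemiring)
  import Algebra.Properties.Semiring.Sum as Sum
  import Algebra.Solver.CommutativeMonoid as +-Solver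
  open import Data.Bool.Base using (if_then_else_)
  open import Data.Fin.Base using (Fin; zero; suc; toℕ)
  open import Data.Fin.Permutation using (Permutation′; _⟨$⟩ʳ_)
  open import Data.Nat.Base as ℕ using (ℕ; zero; suc; _<ᵇ_)
  open import Data.Vec.Functional as Vector using (Vector)
  open import Function.Base using (_∘_)
  open import Level using (0ℓ)
  open import Relation.Binary.Bundles using (Poset)
  import Relation.Binary.Reasoning.PartialOrder
  open import Relation.Binary.Structures using (IsPartialOrder)

  record OrderedSemiring : Set₁ where
    field
      commutativeSemiring : CommutativeSemiring 0ℓ 0ℓ
    open CommutativeSemiring commutativeSemiring public hiding (zero)
    infix 4 _≤_
    field
      _≤_            : Carrier → Carrier → Set
      isPartialOrder : IsPartialOrder _≈_ _≤_
      +-mono-≤       : ∀ {x y u v} → x ≤ y → u ≤ v → x + u ≤ y + v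
      +-cancelʳ-≤    : ∀ {x y} z → x + z ≤ y + z → x ≤ y
      rearrangement  : ∀ {a b p q} → a ≤ b → p ≤ q → a * q + b * p ≤ a * p + b * q
      fromℕ          : ℕ → Carrier
      fromℕ-0        : fromℕ 0 ≈ 0#
      fromℕ-1        : fromℕ 1 ≈ 1#
      fromℕ-+        : ∀ m n → fromℕ (m ℕ.+ n) ≈ fromℕ m + fromℕ n
      fromℕ-*        : ∀ m n → fromℕ (m ℕ.* n) ≈ fromℕ m * fromℕ n
      fromℕ-mono-≤   : ∀ {m n} → m ℕ.≤ n → fromℕ m ≤ fromℕ n

  -- A tail is cut out by coefficients 0 and 1, so that tail sums are linear functionals and fall
  -- under the lemmas on convex combinations. Positions count from 0, and `mask 0` gives the full
  -- sum.
  mask : ∀ {n} → ℕ → Vector ℕ n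
  mask l i = if toℕ i <ᵇ l then 0 else 1

  -- Has two roles: the increasing parking function with the largest tail sums, and the coefficients
  -- of the functional that exposes a vertex.
  position : ∀ {n} → Vector ℕ n
  position i = suc (toℕ i)

  infix 8 _∙ⁿ_
  _∙ⁿ_ : ∀ {n} → Vector ℕ n → Vector ℕ n → ℕ
  c ∙ⁿ a = Vector.foldr ℕ._+_ 0 (λ i → c i ℕ.* a i)

  module WeightedSums (O : OrderedSemiring) where
    open OrderedSemiring O
    open Sum semiring
    open +-Solver +-commutativeMonoid using (solve; _⊜_; _⊕_)

    poset : Poset 0ℓ 0ℓ 0ℓ
    poset = record { isPartialOrder = isPartialOrder }

    open Poset poset public
      using ()
      renaming (refl to ≤-refl; trans to ≤-trans; reflexive to ≤-reflexive; antisym to ≤-antisym)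
    open Relation.Binary.Reasoning.PartialOrder poset

    +-cancelˡ-≤ : ∀ {x y} z → z + x ≤ z + y → x ≤ y
    +-cancelˡ-≤ {x} {y} z h = +-cancelʳ-≤ z (begin
      x + z ≈⟨ +-comm x z ⟩
      z + x ≤⟨ h ⟩
      z + y ≈⟨ +-comm z y ⟩
      y + z ∎)

    +-cancelʳ-≈ : ∀ {x y} z → x + z ≈ y + z → x ≈ y
    +-cancelʳ-≈ z h = ≤-antisym
      (+-cancelʳ-≤ z (≤-reflexive h)) (+-cancelʳ-≤ z (≤-reflexive (sym h)))

    *-monoˡ-≤ : ∀ {z x y} → 0# ≤ z → x ≤ y → z * x ≤ z * y
    *-monoˡ-≤ {z} {x} {y} 0≤z x≤y = begin
      z * x             ≈⟨ +-identityˡ (z * x) ⟨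
      0# + z * x        ≈⟨ +-congʳ (zeroˡ y) ⟨
      0# * y + z * x    ≤⟨ rearrangement 0≤z x≤y ⟩
      0# * x + z * y    ≈⟨ +-congʳ (zeroˡ x) ⟩
      0# + z * y        ≈⟨ +-identityˡ (z * y) ⟩
      z * y             ∎

    sum-mono-≤ : ∀ {n} (x y : Vector Carrier n) → (∀ i → x i ≤ y i) → sum x ≤ sum y
    sum-mono-≤ {zero}  x y h = ≤-refl
    sum-mono-≤ {suc n} x y h = +-mono-≤ (h zero) (sum-mono-≤ (x ∘ suc) (y ∘ suc) (h ∘ suc))

    infix 8 _∙_
    _∙_ : ∀ {n} → Vector Carrier n → Vector Carrier n → Carrier
    c ∙ x = sum (λ i → c i * x i)

    embed : ∀ {n} → Vector ℕ n → Vector Carrier n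
    embed a i = fromℕ (a i)

    ∙-cong : ∀ {n} {c d x y : Vector Carrier n} → (∀ i → c i ≈ d i) → (∀ i → x i ≈ y i) → c ∙ x ≈ d ∙ y
    ∙-cong c≈d x≈y = sum-cong-≋ λ i → *-cong (c≈d i) (x≈y i)

    ∙-permute : ∀ {n} (c x : Vector Carrier n) (σ : Permutation′ n) →
                (c ∘ (σ ⟨$⟩ʳ_)) ∙ (x ∘ (σ ⟨$⟩ʳ_)) ≈ c ∙ x
    ∙-permute c x σ = sym (sum-permute (λ i → c i * x i) σ)

    sum-embed : ∀ {n} (a : Vector ℕ n) → sum (embed a) ≈ fromℕ (Vector.foldr ℕ._+_ 0 a)
    sum-embed {zero}  a = sym fromℕ-0
    sum-embed {suc n} a = trans (+-congˡ (sum-embed (a ∘ suc))) (sym (fromℕ-+ _ _))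

    embed-∙ : ∀ {n} (c a : Vector ℕ n) → embed c ∙ embed a ≈ fromℕ (c ∙ⁿ a)
    embed-∙ c a = trans (sum-cong-≋ λ i → sym (fromℕ-* (c i) (a i))) (sum-embed λ i → c i ℕ.* a i)

    tailSum : ∀ {n} → ℕ → Vector Carrier n → Carrier
    tailSum l y = embed (mask l) ∙ y

    tailSum-zero : ∀ {n} (y : Vector Carrier n) → tailSum 0 y ≈ sum y
    tailSum-zero y = sum-cong-≋ λ i → trans (*-congʳ fromℕ-1) (*-identityˡ (y i))

    tailSum-suc : ∀ {n} l (y : Vector Carrier (suc n)) → tailSum (suc l) y ≈ tailSum l (y ∘ suc)
    tailSum-suc l y = trans (+-congʳ (trans (*-congʳ fromℕ-0) (zeroˡ (y zero)))) (+-identityˡ _)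

    -- Majorization read in one fixed order of the coordinates. The other orders are reached by
    -- permuting `y`, under which the slice is invariant.
    Dominates : ∀ {n} → Vector Carrier n → Vector Carrier n → Set
    Dominates v y = ∀ l → tailSum l y ≤ tailSum l v

    Dominates-tail : ∀ {n} (v y : Vector Carrier (suc n)) →
                     Dominates v y → Dominates (v ∘ suc) (y ∘ suc)
    Dominates-tail v y d l = begin
      tailSum l (y ∘ suc)  ≈⟨ tailSum-suc l y ⟨
      tailSum (suc l) y    ≤⟨ d (suc l) ⟩
      tailSum (suc l) v    ≈⟨ tailSum-suc l v ⟩
      tailSum l (v ∘ suc)  ∎

    Dominates-sum : ∀ {n} (v y : Vector Carrier n) → Dominates v y → sum y ≤ sum v
    Dominates-sum v y d = begin
      sum y        ≈⟨ tailSum-zero y ⟨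
      tailSum 0 y  ≤⟨ d 0 ⟩
      tailSum 0 v  ≈⟨ tailSum-zero v ⟩
      sum v        ∎

    Increasing : ∀ {n} → Vector Carrier n → Set
    Increasing c = ∀ i j → toℕ i ℕ.≤ toℕ j → c i ≤ c j

    -- Abel summation: c ∙ (v - y) - c₀ * sum (v - y) is the sum of the
    -- products (cᵢ - cᵢ₋₁) * tailSum i (v - y).
    abel : ∀ {n} (c v y : Vector Carrier (suc n)) → Increasing c → Dominates v y →
           c ∙ y + c zero * sum v ≤ c ∙ v + c zero * sum y
    abel {zero} c v y inc dom = ≤-reflexive (begin-equality
      (c₀ * y₀ + 0#) + c₀ * (v₀ + 0#)
        ≈⟨ +-cong (+-identityʳ _) (*-congˡ (+-identityʳ v₀)) ⟩
      c₀ * y₀ + c₀ * v₀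
        ≈⟨ +-comm _ _ ⟩
      c₀ * v₀ + c₀ * y₀
        ≈⟨ +-cong (+-identityʳ _) (*-congˡ (+-identityʳ y₀)) ⟨
      (c₀ * v₀ + 0#) + c₀ * (y₀ + 0#) ∎)
      where
      c₀ = c zero
      v₀ = v zero
      y₀ = y zero
    -- Adding `c₁ * V + c₁ * Y` to both sides makes room for two inequalities: the induction
    -- hypothesis `cy + c₁ * V ≤ cv + c₁ * Y`, and `c₀ * V + c₁ * Y ≤ c₀ * Y + c₁ * V`, which is
    -- `rearrangement` for `c₀ ≤ c₁` and `Y ≤ V`.
    abel {suc n} c v y inc dom = +-cancelʳ-≤ (c₁ * V + c₁ * Y) (begin
      ((c₀ * y₀ + cy) + c₀ * (v₀ + V)) + (c₁ * V + c₁ * Y)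
        ≈⟨ +-congʳ (+-congˡ (distribˡ c₀ v₀ V)) ⟩
      ((c₀ * y₀ + cy) + (c₀ * v₀ + c₀ * V)) + (c₁ * V + c₁ * Y)
        ≈⟨ solve 6 (λ a x b e f g → ((a ⊕ x) ⊕ (b ⊕ e)) ⊕ (f ⊕ g) ⊜ (a ⊕ b) ⊕ ((x ⊕ f) ⊕ (e ⊕ g)))
             refl (c₀ * y₀) cy (c₀ * v₀) (c₀ * V) (c₁ * V) (c₁ * Y) ⟩
      (c₀ * y₀ + c₀ * v₀) + ((cy + c₁ * V) + (c₀ * V + c₁ * Y))
        ≤⟨ +-mono-≤ ≤-refl (+-mono-≤
             (abel (c ∘ suc) (v ∘ suc) (y ∘ suc) (λ i j i≤j → inc (suc i) (suc j) (ℕ.s≤s i≤j)) dom′)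
             (rearrangement (inc zero (suc zero) ℕ.z≤n) (Dominates-sum (v ∘ suc) (y ∘ suc) dom′))) ⟩
      (c₀ * y₀ + c₀ * v₀) + ((cv + c₁ * Y) + (c₀ * Y + c₁ * V))
        ≈⟨ solve 6 (λ a x b e f g → (a ⊕ b) ⊕ ((x ⊕ g) ⊕ (e ⊕ f)) ⊜ ((b ⊕ x) ⊕ (a ⊕ e)) ⊕ (f ⊕ g))
             refl (c₀ * y₀) cv (c₀ * v₀) (c₀ * Y) (c₁ * V) (c₁ * Y) ⟩
      ((c₀ * v₀ + cv) + (c₀ * y₀ + c₀ * Y)) + (c₁ * V + c₁ * Y)
        ≈⟨ +-congʳ (+-congˡ (distribˡ c₀ y₀ Y)) ⟨
      ((c₀ * v₀ + cv) + c₀ * (y₀ + Y)) + (c₁ * V + c₁ * Y) ∎)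
      where
      dom′ = Dominates-tail v y dom
      c₀ = c zero
      c₁ = c (suc zero)
      v₀ = v zero
      y₀ = y zero
      V  = sum (v ∘ suc)
      Y  = sum (y ∘ suc)
      cv = (c ∘ suc) ∙ (v ∘ suc)
      cy = (c ∘ suc) ∙ (y ∘ suc)

    dominated-∙-≤ : ∀ {n} (c v y : Vector Carrier n) → Increasing c →
                    Dominates v y → sum y ≈ sum v → c ∙ y ≤ c ∙ v
    dominated-∙-≤ {zero}  c v y inc dom y≈v = ≤-refl
    dominated-∙-≤ {suc n} c v y inc dom y≈v = +-cancelʳ-≤ (c zero * sum v) (begin
      c ∙ y + c zero * sum v  ≤⟨ abel c v y inc dom ⟩
      c ∙ v + c zero * sum y  ≈⟨ +-congˡ (*-congˡ y≈v) ⟩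
      c ∙ v + c zero * sum v  ∎)

    -- Iterated, this says that embed position ∙ y is the sum of all tail sums.
    position-∙ : ∀ {n} (y : Vector Carrier (suc n)) →
                 embed position ∙ y ≈ sum y + embed position ∙ (y ∘ suc)
    position-∙ {n} y = begin-equality
      fromℕ 1 * y zero + sum (λ i → fromℕ (1 ℕ.+ position i) * y (suc i))
        ≈⟨ +-cong (trans (*-congʳ fromℕ-1) (*-identityˡ _)) (sum-cong-≋ step) ⟩
      y zero + sum (λ i → y (suc i) + embed position i * y (suc i))
        ≈⟨ +-congˡ (∑-distrib-+ (y ∘ suc) (λ i → embed position i * y (suc i))) ⟩
      y zero + (sum (y ∘ suc) + embed position ∙ (y ∘ suc))
        ≈⟨ +-assoc _ _ _ ⟨
      sum y + embed position ∙ (y ∘ suc) ∎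
      where
      step : ∀ (i : Fin n) → fromℕ (1 ℕ.+ position i) * y (suc i) ≈ y (suc i) + embed position i * y (suc i)
      step i = begin-equality
        fromℕ (1 ℕ.+ position i) * y (suc i)
          ≈⟨ *-congʳ (trans (fromℕ-+ 1 (position i)) (+-congʳ fromℕ-1)) ⟩
        (1# + embed position i) * y (suc i)
          ≈⟨ distribʳ _ _ _ ⟩
        1# * y (suc i) + embed position i * y (suc i)
          ≈⟨ +-congʳ (*-identityˡ _) ⟩
        y (suc i) + embed position i * y (suc i) ∎

    position-∙-mono : ∀ {n} (v y : Vector Carrier n) → Dominates v y →
                      embed position ∙ y ≤ embed position ∙ v
    position-∙-mono {zero}  v y dom = ≤-refl
    position-∙-mono {suc n} v y dom = begin
      embed position ∙ y                        ≈⟨ position-∙ y ⟩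
      sum y + embed position ∙ (y ∘ suc)        ≤⟨ +-mono-≤ (Dominates-sum v y dom)
                                                     (position-∙-mono (v ∘ suc) (y ∘ suc) (Dominates-tail v y dom)) ⟩
      sum v + embed position ∙ (v ∘ suc)        ≈⟨ position-∙ v ⟨
      embed position ∙ v                        ∎

    -- Both sides are sums of tail sums, compared term by term. If the totals agree then so does
    -- every tail sum, and consecutive tail sums differ by one entry.
    position-∙-strict : ∀ {n} (v y : Vector Carrier n) → Dominates v y →
                        embed position ∙ v ≤ embed position ∙ y → ∀ i → y i ≈ v i
    position-∙-strict {zero}  v y dom v≤y ()
    position-∙-strict {suc n} v y dom v≤y =
      λ { zero    → +-cancelʳ-≈ (sum (v ∘ suc)) (trans (+-congˡ (sym (sum-cong-≋ tails))) sums)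
        ; (suc i) → tails i }
      where
      step : sum v + embed position ∙ (v ∘ suc) ≤ sum y + embed position ∙ (y ∘ suc)
      step = begin
        sum v + embed position ∙ (v ∘ suc)  ≈⟨ position-∙ v ⟨
        embed position ∙ v                  ≤⟨ v≤y ⟩
        embed position ∙ y                  ≈⟨ position-∙ y ⟩
        sum y + embed position ∙ (y ∘ suc)  ∎
      sums : sum y ≈ sum v
      sums = ≤-antisym (Dominates-sum v y dom) (+-cancelʳ-≤ (embed position ∙ (v ∘ suc))
        (≤-trans step (+-mono-≤ ≤-refl (position-∙-mono (v ∘ suc) (y ∘ suc) (Dominates-tail v y dom)))))
      tails : ∀ i → y (suc i) ≈ v (suc i)
      tails = position-∙-strict (v ∘ suc) (y ∘ suc) (Dominates-tail v y dom) (+-cancelˡ-≤ (sum y)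
        (≤-trans (≤-reflexive (+-congʳ sums)) step))

    module _ {m n} (w : Vector Carrier m) (p : Vector (Vector Carrier n) m) (x : Vector Carrier n)
             (0≤w : ∀ j → 0# ≤ w j) (∑w≈1 : sum w ≈ 1#)
             (x≈wp : ∀ i → x i ≈ sum (λ j → w j * p j i)) where

      -- The constant `b` can be spread over the points because the weights sum to one.
      combination-affine : ∀ c b → c ∙ x + b ≈ sum (λ j → w j * (c ∙ p j + b))
      combination-affine c b = begin-equality
        c ∙ x + b
          ≈⟨ +-cong (sum-cong-≋ λ i → *-congˡ (x≈wp i)) (sym (trans (*-congʳ ∑w≈1) (*-identityˡ b))) ⟩
        sum (λ i → c i * sum (λ j → w j * p j i)) + sum w * b
          ≈⟨ +-cong (sum-cong-≋ λ i → *-distribˡ-sum (c i) (λ j → w j * p j i)) (*-distribʳ-sum b w) ⟩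
        sum (λ i → sum (λ j → c i * (w j * p j i))) + sum (λ j → w j * b)
          ≈⟨ +-congʳ (∑-comm (λ i j → c i * (w j * p j i))) ⟩
        sum (λ j → sum (λ i → c i * (w j * p j i))) + sum (λ j → w j * b)
          ≈⟨ ∑-distrib-+ (λ j → sum (λ i → c i * (w j * p j i))) (λ j → w j * b) ⟨
        sum (λ j → sum (λ i → c i * (w j * p j i)) + w j * b)
          ≈⟨ sum-cong-≋ (λ j → begin-equality
               sum (λ i → c i * (w j * p j i)) + w j * b
                 ≈⟨ +-congʳ (sum-cong-≋ λ i → swap (c i) (w j) (p j i)) ⟩
               sum (λ i → w j * (c i * p j i)) + w j * b
                 ≈⟨ +-congʳ (*-distribˡ-sum (w j) (λ i → c i * p j i)) ⟨
               w j * (c ∙ p j) + w j * b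
                 ≈⟨ distribˡ (w j) (c ∙ p j) b ⟨
               w j * (c ∙ p j + b) ∎) ⟩
        sum (λ j → w j * (c ∙ p j + b)) ∎
        where
        swap : ∀ a b c → a * (b * c) ≈ b * (a * c)
        swap a b c = trans (sym (*-assoc a b c)) (trans (*-congʳ (*-comm a b)) (*-assoc b a c))

      -- Without subtraction the two functionals cannot be merged into one, hence an affine form on
      -- each side.
      combination-≤ : ∀ c b d e → (∀ j → c ∙ p j + b ≤ d ∙ p j + e) → c ∙ x + b ≤ d ∙ x + e
      combination-≤ c b d e h = begin
        c ∙ x + b                        ≈⟨ combination-affine c b ⟩
        sum (λ j → w j * (c ∙ p j + b))  ≤⟨ sum-mono-≤ _ _ (λ j → *-monoˡ-≤ (0≤w j) (h j)) ⟩
        sum (λ j → w j * (d ∙ p j + e))  ≈⟨ combination-affine d e ⟨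
        d ∙ x + e                        ∎

-- Tail sums of parking functions.

module Parking where
  open import Algebra.Properties.CommutativeMonoid.Sum using (sum-permute)
  open import Data.Bool.Base using (true; false; T; if_then_else_)
  open import Data.Fin.Base using (Fin; zero; suc; toℕ; fromℕ<; punchIn)
  import Data.Fin.Permutation as Perm
  open Perm using (Permutation′; _⟨$⟩ʳ_; _⟨$⟩ˡ_)
  import Data.Fin.Properties as Fin
  open import Data.Nat.Base
  open import Data.Nat.DivMod using (m*n/n≡m)
  open import Data.Nat.Properties
  open import Data.Nat.Tactic.RingSolver using (solve-∀)
  open import Data.Product.Base using (∃; _×_; _,_; proj₁)
  open import Data.Sum.Base using (_⊎_; inj₁; inj₂)
  open import Data.Vec.Functional as Vector using (Vector)
  open import Defs using (IsParkingFunction; vertexVector)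
  open import Function.Base using (_∘_)
  open import Relation.Binary.Definitions using (tri<; tri≈; tri>)
  open import Relation.Binary.PropositionalEquality
  open import Relation.Nullary using (¬_; yes; no; contradiction)
  open Majorization using (mask; position; _∙ⁿ_)

  total : ∀ {n} → Vector ℕ n → ℕ
  total = Vector.foldr _+_ 0

  total-mono-≤ : ∀ {n} (u v : Vector ℕ n) → (∀ i → u i ≤ v i) → total u ≤ total v
  total-mono-≤ {zero}  u v h = z≤n
  total-mono-≤ {suc n} u v h = +-mono-≤ (h zero) (total-mono-≤ (u ∘ suc) (v ∘ suc) (h ∘ suc))

  total-mono-< : ∀ {n} (u v : Vector ℕ n) → (∀ i → u i ≤ v i) → ∀ j → u j < v j → total u < total v
  total-mono-< u v h zero    lt = +-mono-<-≤ lt (total-mono-≤ (u ∘ suc) (v ∘ suc) (h ∘ suc))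
  total-mono-< u v h (suc j) lt = +-mono-≤-< (h zero) (total-mono-< (u ∘ suc) (v ∘ suc) (h ∘ suc) j lt)

  total-cong : ∀ {n} (u v : Vector ℕ n) → (∀ i → u i ≡ v i) → total u ≡ total v
  total-cong {zero}  u v h = refl
  total-cong {suc n} u v h = cong₂ _+_ (h zero) (total-cong (u ∘ suc) (v ∘ suc) (h ∘ suc))

  total-+ : ∀ {n} (u v : Vector ℕ n) → total (λ i → u i + v i) ≡ total u + total v
  total-+ {zero}  u v = refl
  total-+ {suc n} u v = trans (cong (u zero + v zero +_) (total-+ (u ∘ suc) (v ∘ suc)))
    (interchange (u zero) (v zero) (total (u ∘ suc)) (total (v ∘ suc)))
    where
    interchange : ∀ a b c d → a + b + (c + d) ≡ a + c + (b + d)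
    interchange = solve-∀

  total-suc : ∀ {n} (u v : Vector ℕ n) j → u j ≡ suc (v j) →
              (∀ i → toℕ i ≢ toℕ j → u i ≡ v i) → total u ≡ suc (total v)
  total-suc u v zero    at off = cong₂ _+_ at (total-cong (u ∘ suc) (v ∘ suc) (λ i → off (suc i) λ ()))
  total-suc u v (suc j) at off = trans
    (cong₂ _+_ (off zero λ ()) (total-suc (u ∘ suc) (v ∘ suc) j at (λ i i≢j → off (suc i) (i≢j ∘ suc-injective))))
    (+-suc (v zero) _)

  total-ones : ∀ n → total {n} (λ _ → 1) ≡ n
  total-ones zero    = refl
  total-ones (suc n) = cong suc (total-ones n)

  total-position : ∀ n → total {n} position ≡ n * (n + 1) / 2
  total-position n = sym (trans
    (cong (_/ 2) (trans (cong (n *_) (sym (+-identityʳ (n + 1)))) (sym (twice n 0))))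
    (m*n/n≡m (total {n} position) 2))
    where
    shift : ∀ n o → n * (n + 1 + 2 * suc o) + suc o * 2 ≡ suc n * (suc n + 1 + 2 * o)
    shift = solve-∀
    -- Dropping the first coordinate raises all positions by one; the offset `o` absorbs this in the
    -- induction. Doubling avoids the division.
    twice : ∀ n o → total {n} (λ i → o + position i) * 2 ≡ n * (n + 1 + 2 * o)
    twice zero    o = refl
    twice (suc n) o = begin
      (o + 1 + total {n} (λ i → o + suc (position i))) * 2
        ≡⟨ cong₂ (λ a b → (a + b) * 2) (+-comm o 1) (total-cong _ _ λ (i : Fin n) → +-suc o (position i)) ⟩
      (suc o + total {n} (λ i → suc o + position i)) * 2
        ≡⟨ *-distribʳ-+ 2 (suc o) (total {n} (λ i → suc o + position i)) ⟩
      suc o * 2 + total {n} (λ i → suc o + position i) * 2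
        ≡⟨ cong (suc o * 2 +_) (twice n (suc o)) ⟩
      suc o * 2 + n * (n + 1 + 2 * suc o)
        ≡⟨ +-comm (suc o * 2) _ ⟩
      n * (n + 1 + 2 * suc o) + suc o * 2
        ≡⟨ shift n o ⟩
      suc n * (suc n + 1 + 2 * o) ∎
      where open ≡-Reasoning

  mask-cases : ∀ {n} l (i : Fin n) → (toℕ i < l × mask l i ≡ 0) ⊎ (l ≤ toℕ i × mask l i ≡ 1)
  mask-cases l i with toℕ i <? l
  ... | yes i<l = inj₁ (i<l , cong (if_then 0 else 1) (T⇒≡true (<⇒<ᵇ i<l)))
    where
    T⇒≡true : ∀ {b} → T b → b ≡ true
    T⇒≡true {true} _ = refl
  ... | no i≮l = inj₂ (≮⇒≥ i≮l , cong (if_then 0 else 1) (¬T⇒≡false (i≮l ∘ <ᵇ⇒< (toℕ i) l)))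
    where
    ¬T⇒≡false : ∀ {b} → ¬ T b → b ≡ false
    ¬T⇒≡false {true}  h = contradiction _ h
    ¬T⇒≡false {false} _ = refl

  toℕ-punchIn-≤ : ∀ {n} (j : Fin (suc n)) i → toℕ (punchIn j i) ≤ suc (toℕ i)
  toℕ-punchIn-≤ zero    i       = ≤-refl
  toℕ-punchIn-≤ (suc j) zero    = z≤n
  toℕ-punchIn-≤ (suc j) (suc i) = s≤s (toℕ-punchIn-≤ j i)

  -- The last entries of an increasing sequence are its largest. Deleting position 0 leaves a
  -- permutation `π₀` of the others, and skipping one value with `punchIn` raises an index by at
  -- most one; this is why `f` becomes `f ∘ suc`. At `l = 0` both sides are full sums.
  mask-∙ⁿ-permute-≤ : ∀ {n} l (f : ℕ → ℕ) → (∀ {a b} → a ≤ b → f a ≤ f b) → (π : Permutation′ n) →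
    mask l ∙ⁿ (λ i → f (toℕ (π ⟨$⟩ʳ i))) ≤ mask l ∙ⁿ (λ (i : Fin n) → f (toℕ i))
  mask-∙ⁿ-permute-≤ {n}     zero    f mono π =
    ≤-reflexive (sym (sum-permute +-0-commutativeMonoid (λ (i : Fin n) → 1 * f (toℕ i)) π))
  mask-∙ⁿ-permute-≤ {zero}  (suc l) f mono π = z≤n
  mask-∙ⁿ-permute-≤ {suc n} (suc l) f mono π = begin
    mask l ∙ⁿ (λ i → f (toℕ (π ⟨$⟩ʳ suc i)))
      ≤⟨ total-mono-≤ _ _ (λ i → *-monoʳ-≤ (mask l i) (mono (begin
           toℕ (π ⟨$⟩ʳ suc i)                     ≡⟨ cong toℕ (Perm.punchIn-permute π zero i) ⟩
           toℕ (punchIn (π ⟨$⟩ʳ zero) (π₀ ⟨$⟩ʳ i))  ≤⟨ toℕ-punchIn-≤ (π ⟨$⟩ʳ zero) (π₀ ⟨$⟩ʳ i) ⟩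
           suc (toℕ (π₀ ⟨$⟩ʳ i))                   ∎))) ⟩
    mask l ∙ⁿ (λ i → f (suc (toℕ (π₀ ⟨$⟩ʳ i))))
      ≤⟨ mask-∙ⁿ-permute-≤ l (f ∘ suc) (mono ∘ s≤s) π₀ ⟩
    mask l ∙ⁿ (λ (i : Fin n) → f (suc (toℕ i))) ∎
    where
    open ≤-Reasoning
    π₀ = Perm.remove zero π

  -- Read through the inverse of the sorting permutation, `below` places `a` coordinatewise under a
  -- rearrangement of 1, ..., n.
  parking-tail-≤ : ∀ {n} {a : Vector ℕ n} → IsParkingFunction a → ∀ l → mask l ∙ⁿ a ≤ mask {n} l ∙ⁿ position
  parking-tail-≤ {n} {a} pf l = begin
    mask l ∙ⁿ a
      ≤⟨ total-mono-≤ _ _ (λ i → *-monoʳ-≤ (mask l i) (begin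
           a i                              ≡⟨ cong a (Perm.inverseʳ σ) ⟨
           a (σ ⟨$⟩ʳ (σ ⟨$⟩ˡ i))           ≤⟨ below (σ ⟨$⟩ˡ i) ⟩
           suc (toℕ (σ ⟨$⟩ˡ i))            ∎)) ⟩
    mask l ∙ⁿ (λ i → suc (toℕ (Perm.flip σ ⟨$⟩ʳ i)))
      ≤⟨ mask-∙ⁿ-permute-≤ l suc s≤s (Perm.flip σ) ⟩
    mask {n} l ∙ⁿ position ∎
    where
    open ≤-Reasoning
    open IsParkingFunction pf

  parking-permute : ∀ {n} {a : Vector ℕ n} → IsParkingFunction a → ∀ τ →
                    IsParkingFunction (a ∘ (τ ⟨$⟩ʳ_))
  parking-permute {a = a} pf τ = record
    { inRange    = λ i → inRange (τ ⟨$⟩ʳ i)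
    ; σ          = σ Perm.∘ₚ Perm.flip τ
    ; increasing = λ i j i≤j → subst₂ _≤_ (sym (same i)) (sym (same j)) (increasing i j i≤j)
    ; below      = λ i → subst (_≤ suc (toℕ i)) (sym (same i)) (below i)
    }
    where
    open IsParkingFunction pf
    same : ∀ i → a (τ ⟨$⟩ʳ (τ ⟨$⟩ˡ (σ ⟨$⟩ʳ i))) ≡ a (σ ⟨$⟩ʳ i)
    same i = cong a (Perm.inverseʳ τ)

  -- Every tail sum of such a vector is as large as the total allows: either
  -- the tail is maximal among parking functions, or the rest is minimal.
  record IsTight {n} (v : Vector ℕ n) : Set where
    field
      increasing : ∀ i j → toℕ i ≤ toℕ j → v i ≤ v j
      positive   : ∀ i → 1 ≤ v i
      bounded    : ∀ i → v i ≤ position i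
      cut        : ∀ l → (∀ i → l ≤ toℕ i → v i ≡ position i) ⊎ (∀ i → toℕ i < l → v i ≡ 1)

  module _ {n} {v : Vector ℕ n} (tight : IsTight v) where
    open IsTight tight

    tight-parking : IsParkingFunction v
    tight-parking = record
      { inRange    = λ i → positive i , ≤-trans (bounded i) (Fin.toℕ<n i)
      ; σ          = Perm.id
      ; increasing = increasing
      ; below      = bounded
      }

    -- In the second case `v` is 1 before `l`, where `a` is at least 1. The sum of `a` appears
    -- explicitly since `a` need not have the same sum as `v`.
    tight-tail : ∀ l →
      (∀ {a} → IsParkingFunction a → mask l ∙ⁿ a ≤ mask l ∙ⁿ v) ⊎
      (∀ {a} → IsParkingFunction a → mask l ∙ⁿ a + total v ≤ total a + mask l ∙ⁿ v)
    tight-tail l with cut l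
    ... | inj₁ top = inj₁ λ {a} pf →
      ≤-trans (parking-tail-≤ {n} {a} pf l)
        (≤-reflexive (total-cong (λ i → mask l i * position i) (λ i → mask l i * v i) pointwise))
      where
      pointwise : ∀ i → mask l i * position i ≡ mask l i * v i
      pointwise i with mask-cases l i
      ... | inj₁ (_ , eq)   rewrite eq = refl
      ... | inj₂ (l≤i , eq) = cong (mask l i *_) (sym (top i l≤i))
    ... | inj₂ ones = inj₂ λ {a} pf → begin
      mask l ∙ⁿ a + total v                  ≡⟨ total-+ (λ i → mask l i * a i) v ⟨
      total (λ i → mask l i * a i + v i)     ≤⟨ total-mono-≤ _ _ (pointwise pf) ⟩
      total (λ i → a i + mask l i * v i)     ≡⟨ total-+ a (λ i → mask l i * v i) ⟩
      total a + mask l ∙ⁿ v                  ∎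
      where
      open ≤-Reasoning
      pointwise : ∀ {a} → IsParkingFunction a → ∀ i → mask l i * a i + v i ≤ a i + mask l i * v i
      pointwise {a} pf i with mask-cases l i
      ... | inj₁ (i<l , eq) rewrite eq | ones i i<l | +-identityʳ (a i) =
        proj₁ (IsParkingFunction.inRange pf i)
      ... | inj₂ (_ , eq)   rewrite eq | *-identityˡ (a i) | *-identityˡ (v i) = ≤-refl

  ones-tight : ∀ {n} → IsTight {n} (λ _ → 1)
  ones-tight = record
    { increasing = λ _ _ _ → ≤-refl
    ; positive   = λ _ → ≤-refl
    ; bounded    = λ _ → s≤s z≤n
    ; cut        = λ _ → inj₂ λ _ _ → refl
    }

  -- The vectors (1, ..., 1, r, k + 2, ..., n).

  module _ {n : ℕ} (r k : ℕ) where
    private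
      v : Vector ℕ n
      v = vertexVector n r k

    vertexVector-< : ∀ i → toℕ i < k → v i ≡ 1
    vertexVector-< i i<k with toℕ i <ᵇ k | <⇒<ᵇ i<k
    ... | true | _ = refl

    vertexVector-≡ : ∀ i → toℕ i ≡ k → v i ≡ r
    vertexVector-≡ i refl with toℕ i <ᵇ toℕ i in eq | toℕ i ≡ᵇ toℕ i | ≡⇒≡ᵇ (toℕ i) (toℕ i) refl
    ... | true  | _    | _ = contradiction (<ᵇ⇒< (toℕ i) (toℕ i) (subst T (sym eq) _)) (<-irrefl refl)
    ... | false | true | _ = refl

    vertexVector-> : ∀ i → k < toℕ i → v i ≡ position i
    vertexVector-> i k<i with toℕ i <ᵇ k in eq
    ... | true = contradiction (<ᵇ⇒< (toℕ i) k (subst T (sym eq) _)) (<-asym k<i)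
    ... | false with toℕ i ≡ᵇ k in eq′
    ...   | true  = contradiction (≡ᵇ⇒≡ (toℕ i) k (subst T (sym eq′) _)) (>⇒≢ k<i)
    ...   | false = refl

    vertexVector-tight : 1 ≤ r → r ≤ suc k → IsTight v
    vertexVector-tight 1≤r r≤1+k = record
      { increasing = increasing ; positive = positive ; bounded = bounded ; cut = cut }
      where
      positive : ∀ i → 1 ≤ v i
      positive i with <-cmp (toℕ i) k
      ... | tri< i<k _ _ = ≤-reflexive (sym (vertexVector-< i i<k))
      ... | tri≈ _ i≡k _ = subst (1 ≤_) (sym (vertexVector-≡ i i≡k)) 1≤r
      ... | tri> _ _ k<i = subst (1 ≤_) (sym (vertexVector-> i k<i)) (s≤s z≤n)
      bounded : ∀ i → v i ≤ position i
      bounded i with <-cmp (toℕ i) k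
      ... | tri< i<k _ _ = subst (_≤ position i) (sym (vertexVector-< i i<k)) (s≤s z≤n)
      ... | tri≈ _ refl _ = subst (_≤ position i) (sym (vertexVector-≡ i refl)) r≤1+k
      ... | tri> _ _ k<i = ≤-reflexive (vertexVector-> i k<i)
      increasing : ∀ i j → toℕ i ≤ toℕ j → v i ≤ v j
      increasing i j i≤j with <-cmp (toℕ i) k | <-cmp (toℕ j) k
      ... | tri< i<k _ _ | _ = subst (_≤ v j) (sym (vertexVector-< i i<k)) (positive j)
      ... | tri≈ _ i≡k _ | tri< j<k _ _ = contradiction (≤-<-trans i≤j j<k) (<-irrefl i≡k)
      ... | tri≈ _ i≡k _ | tri≈ _ j≡k _ = ≤-reflexive (trans (vertexVector-≡ i i≡k) (sym (vertexVector-≡ j j≡k)))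
      ... | _            | tri> _ _ k<j = subst (v i ≤_) (sym (vertexVector-> j k<j)) (≤-trans (bounded i) (s≤s i≤j))
      ... | tri> _ _ k<i | tri≈ _ j≡k _ = contradiction (<-≤-trans k<i i≤j) (<-irrefl (sym j≡k))
      ... | tri> _ _ k<i | tri< j<k _ _ = contradiction (<-trans k<i (≤-<-trans i≤j j<k)) (<-irrefl refl)
      -- Only the entry at index `k` may be neither 1 nor maximal. For `l ≤ k` it lies in the tail
      -- and the rest is all ones; for `l > k` it lies in the rest and the tail is maximal.
      cut : ∀ l → (∀ i → l ≤ toℕ i → v i ≡ position i) ⊎ (∀ i → toℕ i < l → v i ≡ 1)
      cut l with l ≤? k
      ... | yes l≤k = inj₂ λ i i<l → vertexVector-< i (<-≤-trans i<l l≤k)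
      ... | no  l≰k = inj₁ λ i l≤i → vertexVector-> i (<-≤-trans (≰⇒> l≰k) l≤i)

  -- Existence and uniqueness of the pair `(r, k)`.

  module _ {n : ℕ} where
    private
      m : ℕ
      m = suc n

    vertexVector-suc-total : ∀ {r k} → k ≤ n →
      total (vertexVector m (suc r) k) ≡ suc (total (vertexVector m r k))
    vertexVector-suc-total {r} {k} k≤n = total-suc _ _ j
      (trans (vertexVector-≡ (suc r) k j j≡k) (cong suc (sym (vertexVector-≡ r k j j≡k)))) off
      where
      j : Fin m
      j = fromℕ< (s≤s k≤n)
      j≡k : toℕ j ≡ k
      j≡k = Fin.toℕ-fromℕ< (s≤s k≤n)
      off : ∀ i → toℕ i ≢ toℕ j → vertexVector m (suc r) k i ≡ vertexVector m r k i
      off i i≢j with <-cmp (toℕ i) k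
      ... | tri< i<k _ _ = trans (vertexVector-< (suc r) k i i<k) (sym (vertexVector-< r k i i<k))
      ... | tri≈ _ i≡k _ = contradiction (trans i≡k (sym j≡k)) i≢j
      ... | tri> _ _ k<i = trans (vertexVector-> (suc r) k i k<i) (sym (vertexVector-> r k i k<i))

    -- The carry of a counter: with `suc k` ones and `r` at its upper limit `2 + k`, the vector is
    -- also the one with `k` ones followed by an `r` equal to 1.
    vertexVector-carry : ∀ k i → vertexVector m (2 + k) (suc k) i ≡ vertexVector m 1 k i
    vertexVector-carry k i with <-cmp (toℕ i) k
    ... | tri< i<k _ _ = trans (vertexVector-< (2 + k) (suc k) i (m<n⇒m<1+n i<k)) (sym (vertexVector-< 1 k i i<k))
    ... | tri≈ _ i≡k _ = trans (vertexVector-< (2 + k) (suc k) i (s≤s (≤-reflexive i≡k))) (sym (vertexVector-≡ 1 k i i≡k))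
    ... | tri> _ _ k<i = trans (at-or-after (m≤n⇒m<n∨m≡n k<i)) (sym (vertexVector-> 1 k i k<i))
      where
      at-or-after : suc k < toℕ i ⊎ suc k ≡ toℕ i → vertexVector m (2 + k) (suc k) i ≡ position i
      at-or-after (inj₁ 1+k<i) = vertexVector-> (2 + k) (suc k) i 1+k<i
      at-or-after (inj₂ 1+k≡i) = trans (vertexVector-≡ (2 + k) (suc k) i (sym 1+k≡i)) (cong suc 1+k≡i)

    -- Admissible pairs have `low` equal to 2. The value 1 also admits the all-ones vector, from
    -- which the counting starts. The length is `suc n`, so `k ≤ n` is the bound of the theorem.
    Pair : ℕ → ℕ → Set
    Pair low s = ∃ λ r → ∃ λ k → low ≤ r × r ≤ suc k × 1 ≤ k × k ≤ n × total (vertexVector m r k) ≡ s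

    -- Raises `r` by one while it is below `k + 1`. Once it is there, the carry turns it into a 1
    -- over one leading one fewer, which is then raised to 2. With `k = 1` no carry is possible, but
    -- the vector is then 1, 2, ..., whose total is already the maximum.
    next : ∀ {s} → suc s ≤ total {m} position → Pair 1 s → Pair 2 (suc s)
    next {s} s<max (r , k , 1≤r , r≤1+k , 1≤k , k≤n , eq) with m≤n⇒m<n∨m≡n r≤1+k
    ... | inj₁ r<1+k = suc r , k , s≤s 1≤r , r<1+k , 1≤k , k≤n , trans (vertexVector-suc-total k≤n) (cong suc eq)
    next {s} s<max (r , suc zero , 1≤r , r≤1+k , 1≤k , k≤n , eq) | inj₂ refl =
      contradiction s<max (≤⇒≯ (≤-reflexive (trans (sym (total-cong _ _ maximal)) eq)))
      where
      maximal : ∀ i → vertexVector m 2 1 i ≡ position i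
      maximal zero          = refl
      maximal (suc zero)    = refl
      maximal (suc (suc i)) = refl
    next {s} s<max (r , suc k@(suc _) , 1≤r , r≤1+k , 1≤k , k<n , eq) | inj₂ refl =
      2 , k , ≤-refl , s≤s (s≤s z≤n) , s≤s z≤n , <⇒≤ k<n ,
      trans (vertexVector-suc-total (<⇒≤ k<n))
        (cong suc (trans (sym (total-cong _ _ (vertexVector-carry k))) eq))

    chain : 1 ≤ n → ∀ d → d + m ≤ total {m} position → Pair 1 (d + m)
    chain 1≤n zero    _  = 1 , n , ≤-refl , s≤s z≤n , 1≤n , ≤-refl , trans (total-cong _ _ ones) (total-ones m)
      where
      ones : ∀ i → vertexVector m 1 n i ≡ 1
      ones i with m≤n⇒m<n∨m≡n (≤-pred (Fin.toℕ<n i))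
      ... | inj₁ i<n = vertexVector-< 1 n i i<n
      ... | inj₂ i≡n = vertexVector-≡ 1 n i i≡n
    chain 1≤n (suc d) le =
      let r , k , 2≤r , rest = next le (chain 1≤n d (<⇒≤ le)) in r , k , <⇒≤ 2≤r , rest

    pair-exists : ∀ s → m < s → s ≤ total {m} position → Pair 2 s
    pair-exists (suc s) (s≤s m≤s) s<max =
      next s<max (subst (Pair 1) (m∸n+n≡m m≤s)
        (chain 1≤n (s ∸ m) (≤-trans (≤-reflexive (m∸n+n≡m m≤s)) (<⇒≤ s<max))))
      where
      1≤n : 1 ≤ n
      -- In length one the maximal total is 1, so no `s` lies in the range.
      1≤n = n≢0⇒n>0 λ { refl → <⇒≱ s<max m≤s }

    -- More leading ones lower the vector coordinatewise, and strictly at index `k`: the entry there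
    -- is 1 in the longer block but `r ≥ 2` in the shorter. Equal totals therefore force equal `k`.
    total-vertexVector-< : ∀ {r k r′ k′} → 2 ≤ r → k ≤ n → r ≤ suc k → 1 ≤ r′ → r′ ≤ suc k′ → k < k′ →
      total (vertexVector m r′ k′) < total (vertexVector m r k)
    total-vertexVector-< {r} {k} {r′} {k′} 2≤r k≤n r≤1+k 1≤r′ r′≤1+k′ k<k′ =
      total-mono-< _ _ pointwise j strict
      where
      j : Fin m
      j = fromℕ< (s≤s k≤n)
      j≡k : toℕ j ≡ k
      j≡k = Fin.toℕ-fromℕ< (s≤s k≤n)
      pointwise : ∀ i → vertexVector m r′ k′ i ≤ vertexVector m r k i
      pointwise i with toℕ i <? k′
      ... | yes i<k′ = subst (_≤ vertexVector m r k i) (sym (vertexVector-< r′ k′ i i<k′))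
        (IsTight.positive (vertexVector-tight r k (<⇒≤ 2≤r) r≤1+k) i)
      ... | no i≮k′ = subst (vertexVector m r′ k′ i ≤_)
        (sym (vertexVector-> r k i (<-≤-trans k<k′ (≮⇒≥ i≮k′))))
        (IsTight.bounded (vertexVector-tight r′ k′ 1≤r′ r′≤1+k′) i)
      strict : vertexVector m r′ k′ j < vertexVector m r k j
      strict = subst₂ _<_
        (sym (vertexVector-< r′ k′ j (subst (_< k′) (sym j≡k) k<k′)))
        (sym (vertexVector-≡ r k j j≡k)) 2≤r

    vertexVector-total : ∀ {k} → k ≤ n → ∀ r →
      total (vertexVector m r k) ≡ r + total (vertexVector m 0 k)
    vertexVector-total k≤n zero    = refl
    vertexVector-total k≤n (suc r) =
      trans (vertexVector-suc-total k≤n) (cong suc (vertexVector-total k≤n r))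

    pair-unique : ∀ {r k r′ k′} → 2 ≤ r → r ≤ suc k → k ≤ n → 2 ≤ r′ → r′ ≤ suc k′ → k′ ≤ n →
      total (vertexVector m r k) ≡ total (vertexVector m r′ k′) → (r , k) ≡ (r′ , k′)
    pair-unique {r} {k} {r′} {k′} 2≤r r≤ k≤n 2≤r′ r′≤ k′≤n eq with <-cmp k k′
    ... | tri< k<k′ _ _ = contradiction (sym eq) (<⇒≢ (total-vertexVector-< 2≤r k≤n r≤ (<⇒≤ 2≤r′) r′≤ k<k′))
    ... | tri> _ _ k′<k = contradiction eq (<⇒≢ (total-vertexVector-< 2≤r′ k′≤n r′≤ (<⇒≤ 2≤r) r≤ k′<k))
    ... | tri≈ _ refl _ = cong (_, k)
      (+-cancelʳ-≡ _ r r′ (trans (sym (vertexVector-total k≤n r)) (trans eq (vertexVector-total k≤n r′))))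

-- Vertices of the slice.

module SliceVertices where
  open import Data.Fin.Base using (Fin; zero; suc; punchIn)
  import Data.Fin.Permutation as Perm
  open Perm using (Permutation′; _⟨$⟩ʳ_; _⟨$⟩ˡ_)
  import Data.Fin.Properties as Fin
  open import Data.Integer.Base using (ℤ; +_)
  open import Data.Nat.Base as ℕ using (ℕ; zero; suc)
  import Data.Nat.Properties as ℕ
  open import Data.Product.Base using (∃; _×_; _,_; proj₁; proj₂)
  open import Data.Rational.Base as ℚ using (∣_∣)
  import Data.Rational.Properties as ℚ
  open import Data.Sum.Base using (_⊎_; inj₁; inj₂)
  open import Data.Vec.Functional as Vector using (Vector)
  import Defs
  open import Defs hiding (embed; _≤_; _≈_; _*_; _+_; sum)
  open import Function.Base using (_∘_)
  open import Function.Bundles using (Equivalence; _⇔_; mk⇔)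
  open import Relation.Binary.Bundles using (Poset)
  open import Relation.Binary.PropositionalEquality as ≡ using (_≡_)
  open import Relation.Nullary using (¬_; Dec; yes; no; contradiction)
  open import Relation.Nullary.Decidable using (map′; _×-dec_)
  open Parking
  open Majorization

  ℝ-orderedSemiring : OrderedSemiring
  ℝ-orderedSemiring = record
    { commutativeSemiring = RealField.+-*-commutativeSemiring
    ; _≤_            = RealField._≼_
    ; isPartialOrder = Poset.isPartialOrder RealField.≤-poset
    ; +-mono-≤       = RealField.+-mono-≤
    ; +-cancelʳ-≤    = RealField.+-cancelʳ-≤
    ; rearrangement  = RealField.rearrangement
    ; fromℕ          = RealField.fromℕ
    ; fromℕ-0        = RealField.pointwise λ _ → ≡.refl
    ; fromℕ-1        = RealField.pointwise λ _ → ≡.refl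
    ; fromℕ-+        = RealField.fromℕ-+
    ; fromℕ-*        = RealField.fromℕ-*
    ; fromℕ-mono-≤   = RealField.fromℕ-mono-≤
    }

  open RealField using
    (_≃_; mk≃; get≃; _≼_; mk≼; get≼; ≈-stable; ≰⇒≥; approximation; near-unique)
  open OrderedSemiring ℝ-orderedSemiring
    hiding (_≤_; _≈_)
    renaming (refl to ≃-refl; sym to ≃-sym; trans to ≃-trans)
  open WeightedSums ℝ-orderedSemiring
  open import Algebra.Properties.Semiring.Sum semiring
    using (sum; sum-permute; sum-cong-≋; sum-replicate-zero)
  open import Relation.Binary.Reasoning.PartialOrder RealField.≤-poset

  foldr-+ : ∀ (_⊞_ : ℝ → ℝ → ℝ) → (∀ x y → x ⊞ y ≃ x + y) →
            ∀ {n} (x : Vector ℝ n) → Vector.foldr _⊞_ 0ℝ x ≃ sum x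
  foldr-+ _⊞_ ⊞≃+ {zero}  x = ≃-refl
  foldr-+ _⊞_ ⊞≃+ {suc n} x =
    ≃-trans (⊞≃+ (x zero) _) (+-congˡ (foldr-+ _⊞_ ⊞≃+ (x ∘ suc)))

  sum-def : ∀ {n} (x : Vector ℝ n) → Defs.sum x ≃ sum x
  sum-def = foldr-+ Defs._+_ RealField.+-def

  ·-def : ∀ {n} (c x : Vector ℝ n) → c · x ≃ c ∙ x
  ·-def c x = ≃-trans (sum-def λ i → c i Defs.* x i) (sum-cong-≋ λ i → RealField.*-def (c i) (x i))

  ¬¬-least : ∀ {n} (c : Vector ℝ (suc n)) → ¬ ¬ (∃ λ m → ∀ i → c m ≼ c i)
  ¬¬-least {zero}  c k = k (zero , λ { zero → ≤-refl })
  ¬¬-least {suc n} c k = ¬¬-least (c ∘ suc) λ (m , least) →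
    let c₀≰cₘ = λ c₀≤cₘ → k (zero , λ { zero → ≤-refl ; (suc i) → ≤-trans c₀≤cₘ (least i) })
    in k (suc m , λ { zero → ≰⇒≥ c₀≰cₘ ; (suc i) → least i })

  -- Real numbers cannot be sorted constructively, but it is not
  -- contradictory that they can be.
  ¬¬-sort : ∀ {n} (c : Vector ℝ n) → ¬ ¬ (∃ λ (σ : Permutation′ n) → Increasing (c ∘ (σ ⟨$⟩ʳ_)))
  ¬¬-sort {zero}  c k = k (Perm.id , λ ())
  ¬¬-sort {suc n} c k = ¬¬-least c λ (m , least) → ¬¬-sort (c ∘ punchIn m) λ (σ , sorted) →
    k (Perm.insert zero m σ , λ
      { zero    j       _   → least (Perm.insert zero m σ ⟨$⟩ʳ j)
      ; (suc i) (suc j) i≤j → ≡.subst₂ (λ a b → c a ≼ c b)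
          (≡.sym (Perm.insert-punchIn zero m σ i)) (≡.sym (Perm.insert-punchIn zero m σ j))
          (sorted i j (ℕ.≤-pred i≤j)) })

  -- Searches for a perfect matching: try each partner `j` of index 0, then match the rest with `j`
  -- skipped. Applied to rational approximations, it finds a candidate rearrangement by a finite
  -- search.
  permutation? : ∀ {n} {R : Fin n → Fin n → Set} → (∀ i j → Dec (R i j)) →
                 Dec (∃ λ (σ : Permutation′ n) → ∀ i → R i (σ ⟨$⟩ʳ i))
  permutation? {zero}      R? = yes (Perm.id , λ ())
  permutation? {suc n} {R} R? = map′ to from
    (Fin.any? λ j → R? zero j ×-dec permutation? λ i k → R? (suc i) (punchIn j k))
    where
    to : (∃ λ j → R zero j × ∃ λ (σ : Permutation′ n) → ∀ i → R (suc i) (punchIn j (σ ⟨$⟩ʳ i))) →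
         ∃ λ (σ : Permutation′ (suc n)) → ∀ i → R i (σ ⟨$⟩ʳ i)
    to (j , r , σ , rs) = Perm.insert zero j σ , λ
      { zero    → r
      ; (suc i) → ≡.subst (R (suc i)) (≡.sym (Perm.insert-punchIn zero j σ i)) (rs i) }
    from : (∃ λ (σ : Permutation′ (suc n)) → ∀ i → R i (σ ⟨$⟩ʳ i)) →
           ∃ λ j → R zero j × ∃ λ (σ : Permutation′ n) → ∀ i → R (suc i) (punchIn j (σ ⟨$⟩ʳ i))
    from (σ , rs) = σ ⟨$⟩ʳ zero , rs zero , Perm.remove zero σ , λ i →
      ≡.subst (R (suc i)) (Perm.punchIn-permute σ zero i) (rs (suc i))

  -- The approximations `q` are matched with entries of `v` at distance below one half. If no
  -- matching exists, no rearrangement does. If `σ` is one, any rearrangement `τ` has the same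
  -- values, since `q i` is that close to only one natural; so each equation holds up to double
  -- negation, and equality of reals is stable.
  rearrangement-stable : ∀ {n} (v : Vector ℕ n) x → ¬ ¬ IsRearrangementOf v x → IsRearrangementOf v x
  rearrangement-stable v x ¬¬h = case (permutation? λ i j → ∣ q i ℚ.- + v j ℚ./ 1 ∣ ℚ.<? ℚ.½)
    where
    q = λ i → proj₁ (approximation (x i))
    near : ∀ i m → x i ≃ fromℕ m → ∣ q i ℚ.- + m ℚ./ 1 ∣ ℚ.< ℚ.½
    near i = proj₂ (approximation (x i))
    case : Dec (∃ λ σ → ∀ i → ∣ q i ℚ.- + v (σ ⟨$⟩ʳ i) ℚ./ 1 ∣ ℚ.< ℚ.½) → IsRearrangementOf v x
    case (yes (σ , close)) = σ , λ i → get≃ (≈-stable λ x≄v → ¬¬h λ (τ , x≈vτ) →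
      x≄v (≡.subst (λ m → x i ≃ fromℕ m)
        (near-unique (q i) {v (τ ⟨$⟩ʳ i)} {v (σ ⟨$⟩ʳ i)}
          (near i (v (τ ⟨$⟩ʳ i)) (mk≃ (x≈vτ i))) (close i))
        (mk≃ {y = fromℕ (v (τ ⟨$⟩ʳ i))} (x≈vτ i))))
    case (no none) = contradiction
      (λ (τ , x≈vτ) → none (τ , λ i → near i (v (τ ⟨$⟩ʳ i)) (mk≃ (x≈vτ i)))) ¬¬h

  module _ {n : ℕ} (S : ℤ) where

    slice-resp : ∀ {x y : Vector ℝ n} → (∀ i → x i ≃ y i) → 𝒫-slice n S x → 𝒫-slice n S y
    slice-resp {x} {y} x≃y ((m , w , p , 0≤w , ∑w , p∈ , x≈) , ∑x≈S) =
      (m , w , p , 0≤w , ∑w , p∈ , λ i → get≃ (≃-trans (≃-sym (x≃y i)) (x≃ i))) , get≃ ∑y≃S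
      where
      x≃ : ∀ i → x i ≃ w · (λ j → p j i)
      x≃ i = mk≃ (x≈ i)
      ∑y≃S : Defs.sum y ≃ fromℤ S
      ∑y≃S = ≃-trans (sum-def y) (≃-trans (≃-sym (sum-cong-≋ x≃y)) (≃-trans (≃-sym (sum-def x)) (mk≃ ∑x≈S)))

    slice-permute : ∀ {x : Vector ℝ n} τ → 𝒫-slice n S x → 𝒫-slice n S (x ∘ (τ ⟨$⟩ʳ_))
    slice-permute {x} τ ((m , w , p , 0≤w , ∑w , p∈ , x≈) , ∑x≈S) =
      (m , w , (λ j → p j ∘ (τ ⟨$⟩ʳ_)) , 0≤w , ∑w
        , (λ j → let a , pf , p≈a = p∈ j in a ∘ (τ ⟨$⟩ʳ_) , parking-permute pf τ , p≈a ∘ (τ ⟨$⟩ʳ_))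
        , x≈ ∘ (τ ⟨$⟩ʳ_)) ,
      get≃ ∑xτ≃S
      where
      ∑xτ≃S : Defs.sum (x ∘ (τ ⟨$⟩ʳ_)) ≃ fromℤ S
      ∑xτ≃S = ≃-trans (sum-def (x ∘ (τ ⟨$⟩ʳ_)))
        (≃-trans (≃-sym (sum-permute x τ)) (≃-trans (≃-sym (sum-def x)) (mk≃ ∑x≈S)))

  parking∈slice : ∀ {n} {a : Vector ℕ n} → IsParkingFunction a → 𝒫-slice n (+ total a) (embed a)
  parking∈slice {a = a} pf =
    (1 , (λ _ → 1ℝ) , (λ _ → embed a) , (λ _ → get≼ 0≤1) , get≃ (≃-trans (sum-def {1} λ _ → 1ℝ) (+-identityʳ 1ℝ))
      , (λ _ → a , pf , λ i → get≃ (≃-refl {embed a i}))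
      , λ i → get≃ (≃-sym (≃-trans (·-def {1} (λ _ → 1ℝ) (λ _ → embed a i))
          (≃-trans (+-identityʳ (1ℝ * embed a i)) (*-identityˡ (embed a i)))))) ,
    get≃ (≃-trans (sum-def (embed a)) (sum-embed a))
    where
    0≤1 : 0ℝ ≼ 1ℝ
    0≤1 = RealField.pointwise-≤ λ _ → ℚ.<⇒≤ 0<1

  module _ {n} {v : Vector ℕ n} (tight : IsTight v) where
    private
      P : Vector ℝ n → Set
      P = 𝒫-slice n (+ total v)

    v∈slice : P (embed v)
    v∈slice = parking∈slice (tight-parking tight)

    slice-sum : ∀ {y} → P y → sum y ≃ sum (embed v)
    slice-sum {y} (_ , ∑y≈S) = ≃-trans (≃-sym (sum-def y)) (≃-trans (mk≃ ∑y≈S) (≃-sym (sum-embed v)))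

    -- The inequalities of `tight-tail` are affine, so they pass from the parking functions `p j` to
    -- `y`. In the first case the right side is constant, hence the zero functional; in the second
    -- `mask 0` supplies the sum of the point, which cancels because `y` lies on the slice.
    slice-dominated : ∀ {y} → P y → Dominates (embed v) y
    slice-dominated {y} y∈P@((m , w , p , 0≤w , ∑w , p∈ , y≈) , _) l = case (tight-tail tight l)
      where
      ∑w≃1 : sum w ≃ 1ℝ
      ∑w≃1 = ≃-trans (≃-sym (sum-def w)) (mk≃ ∑w)
      y≃ : ∀ i → y i ≃ sum (λ j → w j * p j i)
      y≃ i = ≃-trans (mk≃ (y≈ i)) (·-def w (λ j → p j i))
      zero-∙ : ∀ z → (λ _ → 0ℝ) ∙ z ≃ 0ℝ
      zero-∙ z = ≃-trans (sum-cong-≋ λ i → zeroˡ (z i)) (sum-replicate-zero n)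
      case : (∀ {a} → IsParkingFunction a → mask l ∙ⁿ a ℕ.≤ mask l ∙ⁿ v) ⊎
             (∀ {a} → IsParkingFunction a → mask l ∙ⁿ a ℕ.+ total v ℕ.≤ total a ℕ.+ mask l ∙ⁿ v) →
             tailSum l y ≼ tailSum l (embed v)
      case (inj₁ bound) = begin
        tailSum l y                           ≈⟨ +-identityʳ (tailSum l y) ⟨
        tailSum l y + 0ℝ                      ≤⟨ combination-≤ w p y (mk≼ ∘ 0≤w) ∑w≃1 y≃
                                                   (embed (mask l)) 0ℝ (λ _ → 0ℝ) (tailSum l (embed v)) at ⟩
        (λ _ → 0ℝ) ∙ y + tailSum l (embed v)  ≈⟨ +-congʳ (zero-∙ y) ⟩
        0ℝ + tailSum l (embed v)              ≈⟨ +-identityˡ (tailSum l (embed v)) ⟩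
        tailSum l (embed v)                   ∎
        where
        at : ∀ j → tailSum l (p j) + 0ℝ ≼ (λ _ → 0ℝ) ∙ p j + tailSum l (embed v)
        at j = let a , pf , p≈a = p∈ j in begin
          tailSum l (p j) + 0ℝ                    ≈⟨ +-identityʳ (tailSum l (p j)) ⟩
          tailSum l (p j)                         ≈⟨ ∙-cong {c = embed (mask l)} (λ i → ≃-refl) (mk≃ ∘ p≈a) ⟩
          tailSum l (embed a)                     ≈⟨ embed-∙ (mask l) a ⟩
          fromℕ (mask l ∙ⁿ a)                     ≤⟨ fromℕ-mono-≤ (bound pf) ⟩
          fromℕ (mask l ∙ⁿ v)                     ≈⟨ embed-∙ (mask l) v ⟨
          tailSum l (embed v)                     ≈⟨ +-identityˡ (tailSum l (embed v)) ⟨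
          0ℝ + tailSum l (embed v)                ≈⟨ +-congʳ (zero-∙ (p j)) ⟨
          (λ _ → 0ℝ) ∙ p j + tailSum l (embed v)  ∎
      case (inj₂ bound) = +-cancelˡ-≤ (sum y) (begin
        sum y + tailSum l y                ≈⟨ +-comm (sum y) (tailSum l y) ⟩
        tailSum l y + sum y                ≈⟨ +-congˡ (slice-sum y∈P) ⟩
        tailSum l y + sum (embed v)        ≤⟨ combination-≤ w p y (mk≼ ∘ 0≤w) ∑w≃1 y≃ (embed (mask l))
                                                (sum (embed v)) (embed (mask 0)) (tailSum l (embed v)) at ⟩
        tailSum 0 y + tailSum l (embed v)  ≈⟨ +-congʳ (tailSum-zero y) ⟩
        sum y + tailSum l (embed v)        ∎)
        where
        at : ∀ j → tailSum l (p j) + sum (embed v) ≼ tailSum 0 (p j) + tailSum l (embed v)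
        at j = let a , pf , p≈a = p∈ j in begin
          tailSum l (p j) + sum (embed v)            ≈⟨ +-cong (∙-cong {c = embed (mask l)} (λ i → ≃-refl) (mk≃ ∘ p≈a))
                                                               (sum-embed v) ⟩
          tailSum l (embed a) + fromℕ (total v)      ≈⟨ +-congʳ (embed-∙ (mask l) a) ⟩
          fromℕ (mask l ∙ⁿ a) + fromℕ (total v)      ≈⟨ fromℕ-+ (mask l ∙ⁿ a) (total v) ⟨
          fromℕ (mask l ∙ⁿ a ℕ.+ total v)            ≤⟨ fromℕ-mono-≤ (bound pf) ⟩
          fromℕ (total a ℕ.+ mask l ∙ⁿ v)            ≈⟨ fromℕ-+ (total a) (mask l ∙ⁿ v) ⟩
          fromℕ (total a) + fromℕ (mask l ∙ⁿ v)      ≈⟨ +-cong (sum-embed a) (embed-∙ (mask l) v) ⟨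
          sum (embed a) + tailSum l (embed v)        ≈⟨ +-congʳ (tailSum-zero (embed a)) ⟨
          tailSum 0 (embed a) + tailSum l (embed v)  ≈⟨ +-congʳ (∙-cong {c = embed (mask 0)} (λ i → ≃-refl) (mk≃ ∘ p≈a)) ⟨
          tailSum 0 (p j) + tailSum l (embed v)      ∎

    vertex⇒rearrangement : ∀ {x} → IsVertex P x → IsRearrangementOf v x
    vertex⇒rearrangement {x} (c , b , valid , face) = rearrangement-stable v x λ ¬rearr →
      ¬¬-sort c λ (σ , sorted) → ¬rearr (Perm.flip σ , sorted⇒≈ σ sorted)
      where
      x∈P : P x
      x∈P = proj₁ (Equivalence.to (face x) (λ i → get≃ (≃-refl {x i})))
      c∙x≃b : c ∙ x ≃ b
      c∙x≃b = ≃-trans (≃-sym (·-def c x)) (mk≃ (proj₂ (Equivalence.to (face x) (λ i → get≃ (≃-refl {x i})))))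
      sorted⇒≈ : ∀ σ → Increasing (c ∘ (σ ⟨$⟩ʳ_)) → x ≈ᵛ embed (v ∘ (Perm.flip σ ⟨$⟩ʳ_))
      sorted⇒≈ σ sorted i = get≃ (≃-sym (u≃x i))
        where
        u : Vector ℝ n
        u = embed v ∘ (Perm.flip σ ⟨$⟩ʳ_)
        u∈P : P u
        u∈P = slice-permute (+ total v) (Perm.flip σ) v∈slice
        xσ : Vector ℝ n
        xσ = x ∘ (σ ⟨$⟩ʳ_)
        xσ∈P : P xσ
        xσ∈P = slice-permute (+ total v) σ x∈P
        cσ : Vector ℝ n
        cσ = c ∘ (σ ⟨$⟩ʳ_)
        c·u≼b : c · u ≼ b
        c·u≼b = mk≼ (valid u u∈P)
        b≼c∙u : b ≼ c ∙ u
        b≼c∙u = begin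
          b                        ≈⟨ c∙x≃b ⟨
          c ∙ x                    ≈⟨ ∙-permute c x σ ⟨
          cσ ∙ xσ                  ≤⟨ dominated-∙-≤ cσ (embed v) xσ sorted
                                      (slice-dominated xσ∈P) (slice-sum xσ∈P) ⟩
          cσ ∙ embed v             ≈⟨ ∙-cong {c = cσ} (λ _ → ≃-refl)
                                      (λ i → reflexive (≡.cong (embed v) (Perm.inverseˡ σ {i}))) ⟨
          cσ ∙ (u ∘ (σ ⟨$⟩ʳ_))     ≈⟨ ∙-permute c u σ ⟩
          c ∙ u                    ∎
        c·u≃b : c · u ≃ b
        c·u≃b = ≤-antisym c·u≼b (≤-trans b≼c∙u (≤-reflexive (≃-sym (·-def c u))))
        u≃x : ∀ i → u i ≃ x i
        u≃x i = mk≃ (Equivalence.from (face u) (u∈P , get≃ c·u≃b) i)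

    rearrangement⇒vertex : ∀ {x} → IsRearrangementOf v x → IsVertex P x
    rearrangement⇒vertex {x} (σ , x≈vσ) =
      c , c · x , valid , face
      where
      -- Since `x` is `v` read through `σ`, the coefficients 1, ..., n are read through `σ` as well;
      -- `back` then returns every comparison to the order in which `v` increases.
      c : Vector ℝ n
      c = embed position ∘ (σ ⟨$⟩ʳ_)
      back : Vector ℝ n → Vector ℝ n
      back y = y ∘ (Perm.flip σ ⟨$⟩ʳ_)
      x≃vσ : ∀ i → x i ≃ embed v (σ ⟨$⟩ʳ i)
      x≃vσ i = mk≃ (x≈vσ i)
      vσ∈P : P (embed v ∘ (σ ⟨$⟩ʳ_))
      vσ∈P = slice-permute (+ total v) σ v∈slice
      dominated : ∀ {y} → P y → Dominates (embed v) (back y)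
      dominated y∈P = slice-dominated (slice-permute (+ total v) (Perm.flip σ) y∈P)
      ·-cong : ∀ y → (∀ i → y i ≃ x i) → c · y ≃ c · x
      ·-cong y y≃x = ≃-trans (·-def c y) (≃-trans (∙-cong {c = c} (λ _ → ≃-refl) y≃x) (≃-sym (·-def c x)))
      unsort : ∀ y → c · y ≃ embed position ∙ back y
      unsort y = begin-equality
        c · y                      ≈⟨ ·-def c y ⟩
        c ∙ y                      ≈⟨ ∙-permute c y (Perm.flip σ) ⟨
        back c ∙ back y            ≈⟨ ∙-cong {x = back y}
                                        (λ i → reflexive (≡.cong (embed position) (Perm.inverseʳ σ {i})))
                                        (λ _ → ≃-refl) ⟩
        embed position ∙ back y    ∎
      c·x≃ : c · x ≃ embed position ∙ embed v
      c·x≃ = begin-equality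
        c · x                      ≈⟨ ·-def c x ⟩
        c ∙ x                      ≈⟨ ∙-cong {c = c} (λ _ → ≃-refl) x≃vσ ⟩
        c ∙ (embed v ∘ (σ ⟨$⟩ʳ_))  ≈⟨ ∙-permute (embed position) (embed v) σ ⟩
        embed position ∙ embed v   ∎
      below : ∀ y → P y → c · y ≼ c · x
      below y y∈P = begin
        c · y                     ≈⟨ unsort y ⟩
        embed position ∙ back y   ≤⟨ position-∙-mono (embed v) (back y) (dominated y∈P) ⟩
        embed position ∙ embed v  ≈⟨ c·x≃ ⟨
        c · x                     ∎
      unique : ∀ y → P y → c · y ≃ c · x → ∀ i → y i ≃ x i
      unique y y∈P c·y≃c·x i = begin-equality
        y i                 ≈⟨ reflexive (≡.cong y (Perm.inverseˡ σ)) ⟨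
        back y (σ ⟨$⟩ʳ i)   ≈⟨ position-∙-strict (embed v) (back y) (dominated y∈P) attained (σ ⟨$⟩ʳ i) ⟩
        embed v (σ ⟨$⟩ʳ i)  ≈⟨ x≃vσ i ⟨
        x i                 ∎
        where
        attained : embed position ∙ embed v ≼ embed position ∙ back y
        attained = begin
          embed position ∙ embed v  ≈⟨ c·x≃ ⟨
          c · x                     ≈⟨ c·y≃c·x ⟨
          c · y                     ≈⟨ unsort y ⟩
          embed position ∙ back y   ∎
      valid : ∀ y → P y → c · y Defs.≤ c · x
      valid y y∈P = get≼ (below y y∈P)
      face : ∀ y → (y ≈ᵛ x) ⇔ (P y × c · y Defs.≈ c · x)
      face y = mk⇔ to from
        where
        to : y ≈ᵛ x → P y × c · y Defs.≈ c · x
        to y≈x = slice-resp (+ total v) (λ i → ≃-trans (≃-sym (x≃vσ i)) (≃-sym (y≃x i))) vσ∈P , get≃ (·-cong y y≃x)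
          where
          y≃x : ∀ i → y i ≃ x i
          y≃x i = mk≃ (y≈x i)
        from : P y × c · y Defs.≈ c · x → y ≈ᵛ x
        from (y∈P , c·y≈c·x) i = get≃ (unique y y∈P (mk≃ c·y≈c·x) i)

open import Defs using (𝒫-slice; IsVertex; AdmissiblePair; IsRearrangementOf; vertexVector; _≈ᵛ_; 1ℝ)
open import Data.Integer.Base using (ℤ; +_; _≤_)
open import Data.Nat.Base using (ℕ; _+_; _*_; _/_)
import Data.Nat.Base as ℕ
open import Data.Product using (_×_; _,_; ∃!)
open import Function.Bundles using (_⇔_)
open import Relation.Binary.PropositionalEquality using (_≡_)
open import Data.Fin.Permutation using (id)
open import Data.Integer.Base using (+≤+)
open import Data.Integer.Properties using (+-injective)
open import Data.Nat.Base using (suc)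
open import Data.Nat.Properties using (+-comm; ≤-trans; ≤-reflexive; <⇒≤)
open import Function.Bundles using (mk⇔; Equivalence)
open import Relation.Binary.PropositionalEquality using (refl; sym; trans; cong; subst)
open import Data.Vec.Functional using (Vector)
open Majorization using (position)
open Parking
open SliceVertices

tight-vertices : ∀ {n} {v : Vector ℕ n} → IsTight v → ∀ {S} → + total v ≡ S →
  ∀ x → IsVertex (𝒫-slice n S) x ⇔ IsRearrangementOf v x
tight-vertices tight refl x = mk⇔ (vertex⇒rearrangement tight {x}) (rearrangement⇒vertex tight {x})

admissible-∃! : ∀ n {s} → suc n ℕ.< s → s ℕ.≤ total {suc n} position →
  ∃! _≡_ (AdmissiblePair (suc n) (+ s))
admissible-∃! n {s} n<s s≤max with r , k , 2≤r , r≤1+k , 1≤k , k≤n , eq ← pair-exists s n<s s≤max =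
  (r , k) , (<⇒≤ 2≤r , 1≤k , k≤n , 2≤r , ≤-trans r≤1+k (≤-reflexive (+-comm 1 k)) , cong +_ eq) ,
  λ {(r′ , k′)} (_ , _ , k′≤n , 2≤r′ , r′≤k′+1 , eq′) →
    pair-unique 2≤r r≤1+k k≤n 2≤r′ (≤-trans r′≤k′+1 (≤-reflexive (+-comm k′ 1))) k′≤n
      (trans eq (sym (+-injective eq′)))

proposition5p1 : ∀ (n : ℕ) → 1 ℕ.≤ n →
    (∀ (S : ℤ) → + (n + 1) ≤ S → S ≤ + (n * (n + 1) / 2) →
    ∃! _≡_ (AdmissiblePair n S) ×
    (∀ r k → AdmissiblePair n S (r , k) →
    ∀ x → IsVertex (𝒫-slice n S) x ⇔ IsRearrangementOf (vertexVector n r k) x))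
    × (∀ x → IsVertex (𝒫-slice n (+ n)) x ⇔ x ≈ᵛ (λ _ → 1ℝ))
proposition5p1 (suc n) _ =
  (λ { (+ s) (+≤+ n+1≤s) (+≤+ s≤max) →
       admissible-∃! n (subst (ℕ._≤ s) (+-comm (suc n) 1) n+1≤s)
         (≤-trans s≤max (≤-reflexive (sym (total-position (suc n))))) ,
       λ r k (1≤r , _ , _ , _ , r≤k+1 , eq) →
         tight-vertices (vertexVector-tight r k 1≤r (≤-trans r≤k+1 (≤-reflexive (+-comm k 1)))) eq }) ,
  λ x → let open Equivalence (tight-vertices ones-tight (cong +_ (total-ones (suc n))) x) in
    -- All rearrangements of a constant vector coincide, so the identity serves as witness.
    mk⇔ (λ vertex → let _ , x≈1 = to vertex in x≈1) (λ x≈1 → from (id , x≈1))
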